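{- Let $H=H(n,r,q\mid\sigma)$ be a $\sigma$-hypergraph, where $\sigma$ is a partition of $r$ with $s=s(\sigma)\ge 2$ parts, and let $k$ be an integer with $2\le k\le s$. If $q\ge r(r-1)$ and $n\ge s+1$, then $H$ has a $k$-intersecting Hamiltonian cycle.
   Context: Let $\sigma=(a_1,\ldots,a_s)$ be a partition of the positive integer $r$ into $s=s(\sigma)$ positive parts, with largest part $\Delta$. The $\sigma$-hypergraph $H(n,r,q\mid\sigma)$ is the $r$-uniform hypergraph whose $nq$ vertices are partitioned into $n$ classes $V_1,\ldots,V_n$ of $q$ vertices each, and in which an $r$-subset $K$ of the vertices is an edge if and only if the multiset of non-zero cardinalities $|K\cap V_i|$, $1\le i\le n$, is the partition $\sigma$ of $r$. It is always assumed that $q\ge\Delta$ and $n\ge s$. A sequence $C=(e_1,\ldots,e_p)$ of edges of a hypergraph $H$ is a $k$-intersecting cycle if $|e_i\cap e_{i+1}\cap\cdots\cap e_{i+k-1}|>0$ for $1\le i\le p$, with indices modulo $p$, while any other collection of $k$ or more edges of $C$ (that is, any collection that is not a set of $k$ cyclically consecutive edges) has empty intersection. Write $V(C)=e_1\cup\cdots\cup e_p$. If $V(C)=V(H)$, then $C$ is a $k$-intersecting Hamiltonian cycle. -}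

module Defs where

open import Data.Fin using (Fin; toℕ; quotient; _≟_)
open import Data.Fin.Properties using (nonZeroIndex)
open import Data.Fin.Subset using (Subset; ⊤; ⁅_⁆; ⋃; ⋂; _∩_; ∣_∣; Empty)
open import Data.Fin.Subset.Properties using (_∈?_)
open import Data.List using (List; length; map; filter; upTo; allFin)
open import Data.List.Extrema.Nat using (max)
open import Data.List.Relation.Binary.Permutation.Propositional using (_↭_)
open import Data.List.Relation.Unary.All using (All)
open import Data.Nat using (ℕ; _+_; _*_; _≤_; _<_; _>_; _<?_)
open import Data.Nat.ListAction using (sum)
open import Data.Nat.DivMod using (_mod_)
open import Data.Product using (∃-syntax; _×_)
open import Data.Vec using (tabulate)
open import Level using (0ℓ)
open import Relation.Binary.PropositionalEquality using (_≡_; _≢_)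
open import Relation.Nullary using (does)
open import Relation.Unary using (Pred)

-- The parts are listed in an arbitrary order; the order is irrelevant because
-- a partition is only ever compared up to _↭_.
record Partition (r : ℕ) : Set where
  field
    parts    : List ℕ
    positive : All (0 <_) parts
    sum≡r    : sum parts ≡ r

  size : ℕ
  size = length parts

  largest : ℕ
  largest = max 0 parts

open Partition public

-- A hypergraph on the vertex set Fin N, given by its set of edges.
Hypergraph : ℕ → Set₁
Hypergraph N = Pred (Subset N) 0ℓ

-- The nq vertices Fin (n * q) fall into n consecutive blocks of length q;
-- quotient q v is the block containing v.
vertexClass : ∀ n q → Fin n → Subset (n * q)
vertexClass n q i = tabulate λ v → does (quotient {n} q v ≟ i)

σ-hypergraph : ∀ n {r} q → Partition r → Hypergraph (n * q)
σ-hypergraph n {r} q σ K =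
  ∣ K ∣ ≡ r ×
  filter (0 <?_) (map (λ i → ∣ K ∩ vertexClass n q i ∣) (allFin n)) ↭ parts σ

module _ {N p : ℕ} (e : Fin p → Subset N) where

  -- A collection of members of the sequence e₀ , … , eₚ₋₁ is given by its set
  -- of indices, so a repeated edge counts once for each occurrence.
  intersection : Subset p → Subset N
  intersection S = ⋂ (map e (filter (_∈? S) (allFin p)))

  vertices : Subset N
  vertices = ⋃ (map e (allFin p))

-- The indices i , i + 1 , … , i + k - 1 modulo p.
window : ∀ {p} → ℕ → Fin p → Subset p
window {p} k i = ⋃ (map (λ j → ⁅ (toℕ i + j) mod p ⁆) (upTo k))
  where instance _ = nonZeroIndex i

record IsIntersectingCycle {N p : ℕ} (H : Hypergraph N) (k : ℕ)
                           (e : Fin p → Subset N) : Set where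
  field
    edges       : ∀ i → H (e i)
    consecutive : ∀ i → ∣ intersection e (window k i) ∣ > 0
    otherwise   : ∀ S → k ≤ ∣ S ∣ → (∀ i → S ≢ window k i) →
                  Empty (intersection e S)

HasIntersectingHamiltonianCycle : ∀ {N} → Hypergraph N → ℕ → Set
HasIntersectingHamiltonianCycle {N} H k =
  ∃[ p ] ∃[ e ] IsIntersectingCycle {N} {p} H k e × vertices e ≡ ⊤

{-# OPTIONS --safe #-}

-- The edges are indexed by the times t modulo p = mn.  Give every vertex a
-- starting time and a lifespan l ≤ k and let e_t consist of the vertices alive
-- at time t: no vertex then lies in k edges other than those of a window, so it
-- suffices to have a vertex of lifespan k starting at every time, to meet the
-- classes in the parts of σ at every time, and to use q vertices per class.
--
-- Class c is visited periodically, a visit having age (t + c) mod n at time t,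
-- and the class takes the part of σ that belongs to that age.  If each visit
-- has one vertex of lifespan k and all others have lifespan 1, a visit uses
-- r - k + 1 vertices.  Take m = ⌈q / (r - k + 1)⌉ visits per class; then
-- m ≥ r by the bound on q, and fewer than r - k + 1 vertices per class have
-- to be saved, each by a vertex of lifespan 2 in place of two of lifespan 1.
-- If s ≥ k + 2, or if two parts exceed 1, every visit can save one vertex.
-- Otherwise σ = (a, 1, …, 1) and s ∈ {k , k + 1}; now one visit per class cedes
-- its r - k short-lived vertices to the preceding visit, which takes that many
-- twice in succession and so can save up to r - k of them.  (If s = k + 1, the preceding visit has
-- age s by then, whence the need for n ≥ s + 1.)
module Submission where

open import Defs
open import Data.Bool using (Bool; true; false; _∧_; if_then_else_)
open import Data.Bool.Properties using (∧-zeroʳ; ∧-identityʳ)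
open import Data.Fin using (Fin; zero; suc; toℕ; quotient; remainder; combine; _↑ˡ_; _↑ʳ_; cast)
open import Data.Fin.Properties using (splitAt-↑ˡ; splitAt-↑ʳ; remQuot-combine; toℕ-fromℕ<; toℕ<n; toℕ-injective; cast-involutive; any?) renaming (_≟_ to _≟ᶠ_)
open import Data.Fin.Subset using (Subset; ⊤; ⁅_⁆; ⋃; ⋂; _∩_; _∪_; ∣_∣; Empty; _∈_; _⊆_)
open import Data.Fin.Subset.Properties using (_∈?_; _⊆?_; ⊆-antisym; ∈⊤; ∉⊥; x∈⁅x⁆; x∈⁅y⁆⇒x≡y; x∈p∪q⁺; x∈p∪q⁻; x∈p∩q⁺; x∈p∩q⁻; ∣⊥∣≡0; ∣⁅x⁆∣≡1; p⊆q⇒∣p∣≤∣q∣; p⊂q⇒∣p∣<∣q∣)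
open import Data.List using (List; []; _∷_; _∷ʳ_; _++_; length; map; filter; upTo; allFin; applyUpTo; concat; replicate; lookup)
import Data.List as List
open import Data.List.Membership.Propositional using () renaming (_∈_ to _∈ˡ_)
open import Data.List.Membership.Propositional.Properties using (∈-allFin; ∈-upTo⁺; ∈-upTo⁻; ∈-filter⁺; ∈-filter⁻; ∈-map⁺; ∈-map⁻; ∈-lookup; ∈-++⁺ˡ; ∈-concat⁺′; ∈-applyUpTo⁺)
open import Data.List.Properties using (map-tabulate; tabulate-cong; map-cong; map-++; length-++; length-upTo; length-replicate; applyUpTo-∷ʳ; filter-all)
open import Data.List.Relation.Binary.Permutation.Propositional using (_↭_; ↭-trans; ↭-reflexive; ↭-refl; ↭-sym; prep; swap)
open import Data.List.Relation.Binary.Permutation.Propositional.Properties using (filter-↭; ∷↭∷ʳ; All-resp-↭; ↭-length)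
open import Data.List.Relation.Unary.All as All using (All; []; _∷_)
import Data.List.Relation.Unary.All.Properties as All
open import Data.List.Relation.Unary.Any as Any using (here; there)
open import Data.List.Relation.Unary.Any.Properties using (lookup-index)
open import Data.Nat using (ℕ; zero; suc; _+_; _*_; _∸_; _≤_; _≥_; _<_; _>_; z≤n; s≤s; NonZero; >-nonZero; >-nonZero⁻¹; _<?_; _≟_)
open import Data.Nat.Divisibility using (_∣_; n∣m*n)
open import Data.Nat.DivMod
open import Data.Nat.ListAction using (sum)
open import Data.Nat.ListAction.Properties using (sum-↭; sum-++)
open import Data.Nat.Properties hiding (_≟_; _<?_)
open import Data.Nat.Tactic.RingSolver using (solve-∀)
open import Data.Product using (∃-syntax; _×_; _,_; proj₁; proj₂)
open import Data.Sum using (_⊎_; inj₁; inj₂)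
open import Data.Vec using (tabulate; []; _∷_)
open import Data.Vec.Properties using (lookup∘tabulate; lookup⇒[]=; []=⇒lookup) renaming (tabulate-cong to tabulateᵛ-cong)
open import Function using (_∘_; id)
open import Relation.Binary.PropositionalEquality
open import Relation.Nullary using (Dec; yes; no; does; ¬_; contradiction)
open import Relation.Nullary.Decidable using (dec-true; dec-false; decidable-stable; ¬?; _×-dec_)

-- Cardinalities of vertex sets, class by class

bit : Bool → ℕ
bit b = if b then 1 else 0

∣tabulate∣ : ∀ {n} (f : Fin n → Bool) → ∣ tabulate f ∣ ≡ sum (List.tabulate (bit ∘ f))
∣tabulate∣ {zero}  f = refl
∣tabulate∣ {suc n} f with f zero
... | true  = cong suc (∣tabulate∣ (f ∘ suc))
... | false = ∣tabulate∣ (f ∘ suc)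

∣tabulate∣-+ : ∀ m {n} (f : Fin (m + n) → Bool) →
  ∣ tabulate f ∣ ≡ ∣ tabulate (f ∘ (_↑ˡ n)) ∣ + ∣ tabulate (f ∘ (m ↑ʳ_)) ∣
∣tabulate∣-+ zero    f = refl
∣tabulate∣-+ (suc m) f with f zero
... | true  = cong suc (∣tabulate∣-+ m (f ∘ suc))
... | false = ∣tabulate∣-+ m (f ∘ suc)

onBlocks : ∀ n q → (Fin n → Fin q → Bool) → Fin (n * q) → Bool
onBlocks n q f v = f (quotient q v) (remainder {n} q v)

∣onBlocks∣ : ∀ n q f → ∣ tabulate (onBlocks n q f) ∣ ≡ sum (List.tabulate λ c → ∣ tabulate (f c) ∣)
∣onBlocks∣ zero    q f = refl
∣onBlocks∣ (suc n) q f = trans (∣tabulate∣-+ q (onBlocks (suc n) q f))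
  (cong₂ _+_
    (cong ∣_∣ (tabulateᵛ-cong first))
    (trans (cong ∣_∣ (tabulateᵛ-cong rest)) (∣onBlocks∣ n q (f ∘ suc))))
  where
  first : ∀ u → onBlocks (suc n) q f (u ↑ˡ (n * q)) ≡ f zero u
  first u rewrite splitAt-↑ˡ q u (n * q) = refl
  rest : ∀ v → onBlocks (suc n) q f (q ↑ʳ v) ≡ onBlocks n q (f ∘ suc) v
  rest v rewrite splitAt-↑ʳ q (n * q) v = refl

sum-zeros : ∀ n → sum (List.tabulate {n = n} λ _ → 0) ≡ 0
sum-zeros zero    = refl
sum-zeros (suc n) = sum-zeros n

sum-at : ∀ {n} (g : Fin n → ℕ) i → (∀ c → c ≢ i → g c ≡ 0) → sum (List.tabulate g) ≡ g i
sum-at {suc n} g zero    g≡0 = trans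
  (cong (λ xs → g zero + sum xs) (tabulate-cong (λ c → g≡0 (suc c) λ ())))
  (trans (cong (g zero +_) (sum-zeros n)) (+-identityʳ _))
sum-at g (suc i) g≡0 = trans
  (cong (_+ sum (List.tabulate (g ∘ suc))) (g≡0 zero λ ()))
  (sum-at (g ∘ suc) i λ c c≢i → g≡0 (suc c) (c≢i ∘ λ { refl → refl }))

∩-tabulate : ∀ {n} (f g : Fin n → Bool) → tabulate f ∩ tabulate g ≡ tabulate λ v → f v ∧ g v
∩-tabulate {zero}  f g = refl
∩-tabulate {suc n} f g = cong (f zero ∧ g zero ∷_) (∩-tabulate (f ∘ suc) (g ∘ suc))

∣onBlocks∩class∣ : ∀ n q f i → ∣ tabulate (onBlocks n q f) ∩ vertexClass n q i ∣ ≡ ∣ tabulate (f i) ∣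
∣onBlocks∩class∣ n q f i = begin
  ∣ tabulate (onBlocks n q f) ∩ vertexClass n q i ∣
    ≡⟨ cong ∣_∣ (∩-tabulate (onBlocks n q f) _) ⟩
  ∣ tabulate (onBlocks n q λ c u → f c u ∧ does (c ≟ᶠ i)) ∣
    ≡⟨ ∣onBlocks∣ n q (λ c u → f c u ∧ does (c ≟ᶠ i)) ⟩
  sum (List.tabulate λ c → ∣ tabulate (λ u → f c u ∧ does (c ≟ᶠ i)) ∣)
    ≡⟨ sum-at _ i other ⟩
  ∣ tabulate (λ u → f i u ∧ does (i ≟ᶠ i)) ∣
    ≡⟨ cong ∣_∣ (tabulateᵛ-cong λ u → trans (cong (f i u ∧_) (dec-true (i ≟ᶠ i) refl)) (∧-identityʳ _)) ⟩
  ∣ tabulate (f i) ∣ ∎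
  where
  open ≡-Reasoning
  other : ∀ c → c ≢ i → ∣ tabulate (λ u → f c u ∧ does (c ≟ᶠ i)) ∣ ≡ 0
  other c c≢i = trans
    (∣tabulate∣ (λ u → f c u ∧ does (c ≟ᶠ i)))
    (trans (cong sum (tabulate-cong λ u → cong bit (trans (cong (f c u ∧_) (dec-false (c ≟ᶠ i) c≢i)) (∧-zeroʳ _))))
           (sum-zeros q))

∣tabulate-lookup∣ : ∀ {A : Set} {q} (xs : List A) (eq : length xs ≡ q) (b : A → Bool) →
  ∣ tabulate (λ u → b (lookup xs (cast (sym eq) u))) ∣ ≡ sum (map (bit ∘ b) xs)
∣tabulate-lookup∣ []       refl b = refl
∣tabulate-lookup∣ (x ∷ xs) refl b with b x
... | true  = cong suc (∣tabulate-lookup∣ xs refl b)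
... | false = ∣tabulate-lookup∣ xs refl b

sum-filter-positive : ∀ xs → sum (filter (0 <?_) xs) ≡ sum xs
sum-filter-positive []           = refl
sum-filter-positive (zero  ∷ xs) = sum-filter-positive xs
sum-filter-positive (suc x ∷ xs) = cong (suc x +_) (sum-filter-positive xs)

-- Membership in unions, intersections and windows

∈-tabulate⁺ : ∀ {N} {P : Fin N → Set} (P? : ∀ v → Dec (P v)) {v} → P v → v ∈ tabulate (does ∘ P?)
∈-tabulate⁺ P? {v} Pv = lookup⇒[]= v _ (trans (lookup∘tabulate _ v) (dec-true (P? v) Pv))

∈-tabulate⁻ : ∀ {N} {P : Fin N → Set} (P? : ∀ v → Dec (P v)) {v} → v ∈ tabulate (does ∘ P?) → P v
∈-tabulate⁻ P? {v} v∈ with P? v | trans (sym (lookup∘tabulate (does ∘ P?) v)) ([]=⇒lookup v∈)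
... | yes Pv | _ = Pv
... | no  _  | ()

∈-⋃⁺ : ∀ {N} {v : Fin N} {K Ks} → K ∈ˡ Ks → v ∈ K → v ∈ ⋃ Ks
∈-⋃⁺ (here refl) v∈K = x∈p∪q⁺ (inj₁ v∈K)
∈-⋃⁺ (there K∈)  v∈K = x∈p∪q⁺ (inj₂ (∈-⋃⁺ K∈ v∈K))

∈-⋃⁻ : ∀ {N} {v : Fin N} Ks → v ∈ ⋃ Ks → ∃[ K ] K ∈ˡ Ks × v ∈ K
∈-⋃⁻ []       v∈ = contradiction v∈ ∉⊥
∈-⋃⁻ (K ∷ Ks) v∈ with x∈p∪q⁻ K (⋃ Ks) v∈
... | inj₁ v∈K = K , here refl , v∈K
... | inj₂ v∈⋃ with K′ , K′∈ , v∈K′ ← ∈-⋃⁻ Ks v∈⋃ = K′ , there K′∈ , v∈K′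

∈-⋂⁺ : ∀ {N} {v : Fin N} Ks → (∀ {K} → K ∈ˡ Ks → v ∈ K) → v ∈ ⋂ Ks
∈-⋂⁺ []       _   = ∈⊤
∈-⋂⁺ (K ∷ Ks) all = x∈p∩q⁺ (all (here refl) , ∈-⋂⁺ Ks (all ∘ there))

∈-⋂⁻ : ∀ {N} {v : Fin N} {K} Ks → v ∈ ⋂ Ks → K ∈ˡ Ks → v ∈ K
∈-⋂⁻ (K ∷ Ks) v∈ (here refl) = proj₁ (x∈p∩q⁻ K (⋂ Ks) v∈)
∈-⋂⁻ (K ∷ Ks) v∈ (there K∈)  = ∈-⋂⁻ Ks (proj₂ (x∈p∩q⁻ K (⋂ Ks) v∈)) K∈

∈-window⁺ : ∀ {p} .{{_ : NonZero p}} {l} (i : Fin p) {j} → j < l → (toℕ i + j) mod p ∈ window l i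
∈-window⁺ {suc p} {l = l} i {j} j<l = ∈-⋃⁺ (∈-map⁺ (λ j → ⁅ (toℕ i + j) mod suc p ⁆) (∈-upTo⁺ j<l)) (x∈⁅x⁆ _)

∈-window⁻ : ∀ {p} .{{_ : NonZero p}} {l} (i : Fin p) {t} → t ∈ window l i → ∃[ j ] j < l × t ≡ (toℕ i + j) mod p
∈-window⁻ {suc p} {l} i t∈
  with _ , K∈ , t∈K ← ∈-⋃⁻ _ t∈
  with j , j∈ , refl ← ∈-map⁻ (λ j → ⁅ (toℕ i + j) mod suc p ⁆) K∈
  = j , ∈-upTo⁻ j∈ , x∈⁅y⁆⇒x≡y _ t∈K

∣p∪q∣≤∣p∣+∣q∣ : ∀ {N} (p q : Subset N) → ∣ p ∪ q ∣ ≤ ∣ p ∣ + ∣ q ∣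
∣p∪q∣≤∣p∣+∣q∣ [] [] = z≤n
∣p∪q∣≤∣p∣+∣q∣ (true  ∷ p) (true  ∷ q) = s≤s (≤-trans (∣p∪q∣≤∣p∣+∣q∣ p q) (+-monoʳ-≤ ∣ p ∣ (n≤1+n _)))
∣p∪q∣≤∣p∣+∣q∣ (true  ∷ p) (false ∷ q) = s≤s (∣p∪q∣≤∣p∣+∣q∣ p q)
∣p∪q∣≤∣p∣+∣q∣ (false ∷ p) (true  ∷ q) = ≤-trans (s≤s (∣p∪q∣≤∣p∣+∣q∣ p q)) (≤-reflexive (sym (+-suc ∣ p ∣ ∣ q ∣)))
∣p∪q∣≤∣p∣+∣q∣ (false ∷ p) (false ∷ q) = ∣p∪q∣≤∣p∣+∣q∣ p q

∣⋃-singletons∣ : ∀ {N} {A : Set} (f : A → Fin N) xs → ∣ ⋃ (map (λ x → ⁅ f x ⁆) xs) ∣ ≤ length xs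
∣⋃-singletons∣ {N} f []  = ≤-reflexive (∣⊥∣≡0 N)
∣⋃-singletons∣ f (x ∷ xs) = ≤-trans (∣p∪q∣≤∣p∣+∣q∣ ⁅ f x ⁆ _)
  (+-mono-≤ (≤-reflexive (∣⁅x⁆∣≡1 (f x))) (∣⋃-singletons∣ f xs))

-- Indices may coincide modulo `p`, so this is an upper bound only.
∣window∣≤ : ∀ {p} l (i : Fin p) → ∣ window l i ∣ ≤ l
∣window∣≤ {suc p} l i = ≤-trans (∣⋃-singletons∣ (λ j → (toℕ i + j) mod suc p) (upTo l)) (≤-reflexive (length-upTo l))

p⊆q∧∣q∣≤∣p∣⇒p≡q : ∀ {N} {p q : Subset N} → p ⊆ q → ∣ q ∣ ≤ ∣ p ∣ → p ≡ q
p⊆q∧∣q∣≤∣p∣⇒p≡q {p = p} {q} p⊆q ∣q∣≤∣p∣ with q ⊆? p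
... | yes q⊆p = ⊆-antisym p⊆q q⊆p
... | no  q⊈p = contradiction ∣q∣≤∣p∣ (<⇒≱ (p⊂q⇒∣p∣<∣q∣ (p⊆q , witness)))
  where
  witness : ∃[ x ] x ∈ q × ¬ (x ∈ p)
  witness with any? (λ x → (x ∈? q) ×-dec ¬? (x ∈? p))
  ... | yes w = w
  ... | no ∄ = contradiction (λ {x} x∈q → decidable-stable (x ∈? p) λ x∉p → ∄ (x , x∈q , x∉p)) q⊈p

-- From labelled vertices to a Hamiltonian cycle

-- A vertex labelled (τ , l) lies in the l consecutive edges e_τ , … , e_{τ+l-1}.
Label : ℕ → Set
Label p = Fin p × ℕ

arc : ∀ {p} → Label p → Subset p
arc (τ , l) = window l τ

tally : ∀ {p} → Fin p → List (Label p) → ℕ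
tally t xs = sum (map (λ x → bit (does (t ∈? arc x))) xs)

-- If at least `k` edges share a vertex, their indices lie in its arc, which has at most `k`
-- elements; so they fill the arc, the lifespan is `k`, and the arc is a window. The vertices from
-- `anchor` give every window a common vertex, and `profile` makes every `e t` an edge.
labelled-cycle : ∀ {n q p k r} .{{_ : NonZero p}} (σ : Partition r) (labels : Fin n → List (Label p)) →
  1 ≤ k →
  (∀ c → length (labels c) ≡ q) →
  (∀ c → All (λ x → 1 ≤ proj₂ x × proj₂ x ≤ k) (labels c)) →
  (∀ τ → ∃[ c ] (τ , k) ∈ˡ labels c) →
  (∀ t → filter (0 <?_) (map (λ c → tally t (labels c)) (allFin n)) ↭ parts σ) →
  HasIntersectingHamiltonianCycle (σ-hypergraph n q σ) k
labelled-cycle {n} {q} {p} {k} {r} σ labels 1≤k len bounds anchor profile =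
  p , e , record { edges = edges ; consecutive = consecutive ; otherwise = otherwise } , covered
  where
  open ≡-Reasoning

  at : Fin n → Fin q → Label p
  at c u = lookup (labels c) (cast (sym (len c)) u)

  label : Fin (n * q) → Label p
  label v = at (quotient q v) (remainder {n} q v)

  on? : ∀ t v → Dec (t ∈ arc (label v))
  on? t v = t ∈? arc (label v)

  e : Fin p → Subset (n * q)
  e t = tabulate (does ∘ on? t)

  occupied : Fin p → Fin n → Fin q → Bool
  occupied t c u = does (t ∈? arc (at c u))

  ∣occupied∣ : ∀ t c → ∣ tabulate (occupied t c) ∣ ≡ tally t (labels c)
  ∣occupied∣ t c = ∣tabulate-lookup∣ (labels c) (len c) (λ x → does (t ∈? arc x))

  edges : ∀ t → σ-hypergraph n q σ (e t)
  edges t = ∣e∣ , subst (λ xs → filter (0 <?_) xs ↭ parts σ)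
    (map-cong (λ c → sym (trans (∣onBlocks∩class∣ n q (occupied t) c) (∣occupied∣ t c))) (allFin n))
    (profile t)
    where
    -- The size is the sum of the tallies over the classes, which `profile` identifies with the sum
    -- of the parts.
    ∣e∣ : ∣ e t ∣ ≡ r
    ∣e∣ = begin
      ∣ e t ∣                                             ≡⟨ ∣onBlocks∣ n q (occupied t) ⟩
      sum (List.tabulate λ c → ∣ tabulate (occupied t c) ∣) ≡⟨ cong sum (tabulate-cong (∣occupied∣ t)) ⟩
      sum (List.tabulate λ c → tally t (labels c))        ≡⟨ cong sum (map-tabulate id (λ c → tally t (labels c))) ⟨
      sum (map (λ c → tally t (labels c)) (allFin n))     ≡⟨ sum-filter-positive (map (λ c → tally t (labels c)) (allFin n)) ⟨
      sum (filter (0 <?_) (map (λ c → tally t (labels c)) (allFin n))) ≡⟨ sum-↭ (profile t) ⟩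
      sum (parts σ)                                       ≡⟨ sum≡r σ ⟩
      r                                                   ∎

  label-combine : ∀ c u → label (combine c u) ≡ at c u
  label-combine c u = cong (λ cu → at (proj₁ cu) (proj₂ cu)) (remQuot-combine c u)

  bound : ∀ v → 1 ≤ proj₂ (label v) × proj₂ (label v) ≤ k
  bound v = All.lookup (bounds (quotient q v)) (∈-lookup {xs = labels (quotient q v)} (cast (sym (len (quotient q v))) (remainder {n} q v)))

  anchorVertex : ∀ τ → ∃[ v ] label v ≡ (τ , k)
  anchorVertex τ with c , x∈ ← anchor τ = combine c (cast (len c) (Any.index x∈)) ,
    trans (label-combine c _)
      (trans (cong (lookup (labels c)) (cast-involutive (sym (len c)) (len c) (Any.index x∈))) (sym (lookup-index x∈)))

  consecutive : ∀ i → ∣ intersection e (window k i) ∣ > 0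
  consecutive i with v , eq ← anchorVertex i =
    ≤-trans (≤-reflexive (sym (∣⁅x⁆∣≡1 v))) (p⊆q⇒∣p∣≤∣q∣ {p = ⁅ v ⁆} λ x∈ → subst (_∈ intersection e (window k i)) (sym (x∈⁅y⁆⇒x≡y v x∈)) v∈)
    where
    v∈ : v ∈ intersection e (window k i)
    v∈ = ∈-⋂⁺ _ λ K∈ → case K∈
      where
      case : ∀ {K} → K ∈ˡ map e (filter (_∈? window k i) (allFin p)) → v ∈ K
      case K∈ with t , t∈ , refl ← ∈-map⁻ e K∈ =
        ∈-tabulate⁺ (on? t) (subst (λ x → t ∈ arc x) (sym eq) (proj₂ (∈-filter⁻ (_∈? window k i) {xs = allFin p} t∈)))

  otherwise : ∀ S → k ≤ ∣ S ∣ → (∀ i → S ≢ window k i) → Empty (intersection e S)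
  otherwise S k≤∣S∣ S≢ (v , v∈) = S≢ τ (trans S≡ (cong (λ l → window l τ) l≡k))
    where
    τ = proj₁ (label v)
    l = proj₂ (label v)
    S⊆ : S ⊆ window l τ
    S⊆ {t} t∈S = ∈-tabulate⁻ (on? t) (∈-⋂⁻ _ v∈ (∈-map⁺ e (∈-filter⁺ (_∈? S) (∈-allFin t) t∈S)))
    l≤k : l ≤ k
    l≤k = proj₂ (bound v)
    k≤l : k ≤ l
    k≤l = ≤-trans k≤∣S∣ (≤-trans (p⊆q⇒∣p∣≤∣q∣ S⊆) (∣window∣≤ l τ))
    l≡k : l ≡ k
    l≡k = ≤-antisym l≤k k≤l
    S≡ : S ≡ window l τ
    S≡ = p⊆q∧∣q∣≤∣p∣⇒p≡q S⊆ (≤-trans (∣window∣≤ l τ) (≤-trans l≤k k≤∣S∣))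

  covered : vertices e ≡ ⊤
  covered = ⊆-antisym (λ _ → ∈⊤) λ {v} _ →
    -- Lifespans are at least 1, so a vertex lies in the edge of its starting time; `+ 0` is the
    -- first index of its arc.
    let t = (toℕ (proj₁ (label v)) + 0) mod p in
    ∈-⋃⁺ (∈-map⁺ e (∈-allFin t))
      (∈-tabulate⁺ (on? t) (∈-window⁺ (proj₁ (label v)) (proj₁ (bound v))))

-- Finite sums, the Kronecker delta and periodic functions

m+n+o≡m+o+n : ∀ m n o → m + n + o ≡ m + o + n
m+n+o≡m+o+n = solve-∀

∑ : ℕ → (ℕ → ℕ) → ℕ
∑ n f = sum (applyUpTo f n)

Periodic : ℕ → (ℕ → ℕ) → Set
Periodic n f = ∀ x → f (x + n) ≡ f x

-- The Kronecker delta. Recursion on both arguments reduces `δ (suc a) (suc b)` to `δ a b`, which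
-- drives the inductions on ages. The frequent expression `∑ k (δ j)` is the indicator of `j < k`.
δ : ℕ → ℕ → ℕ
δ zero    zero    = 1
δ zero    (suc _) = 0
δ (suc _) zero    = 0
δ (suc a) (suc b) = δ a b

δ-≡ : ∀ {a b} → a ≡ b → δ a b ≡ 1
δ-≡ {zero}  refl = refl
δ-≡ {suc a} refl = δ-≡ {a} refl

δ-≢ : ∀ {a b} → a ≢ b → δ a b ≡ 0
δ-≢ {zero}  {zero}  a≢b = contradiction refl a≢b
δ-≢ {zero}  {suc b} _   = refl
δ-≢ {suc a} {zero}  _   = refl
δ-≢ {suc a} {suc b} a≢b = δ-≢ {a} {b} (a≢b ∘ cong suc)

δ-iff : ∀ {a b c d} → (a ≡ b → c ≡ d) → (c ≡ d → a ≡ b) → δ a b ≡ δ c d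
δ-iff {a} {b} to from with a ≟ b
... | yes a≡b = trans (δ-≡ a≡b) (sym (δ-≡ (to a≡b)))
... | no  a≢b = trans (δ-≢ a≢b) (sym (δ-≢ (a≢b ∘ from)))

applyUpTo-cong : ∀ {A : Set} {f g : ℕ → A} n → (∀ i → i < n → f i ≡ g i) → applyUpTo f n ≡ applyUpTo g n
applyUpTo-cong zero    f≗g = refl
applyUpTo-cong (suc n) f≗g = cong₂ _∷_ (f≗g 0 (s≤s z≤n)) (applyUpTo-cong n λ i i<n → f≗g (suc i) (s≤s i<n))

∑-cong< : ∀ {f g} n → (∀ i → i < n → f i ≡ g i) → ∑ n f ≡ ∑ n g
∑-cong< n f≗g = cong sum (applyUpTo-cong n f≗g)

∑-cong : ∀ {f g} n → (∀ i → f i ≡ g i) → ∑ n f ≡ ∑ n g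
∑-cong n f≗g = ∑-cong< n λ i _ → f≗g i

∑-+ : ∀ n f g → ∑ n (λ i → f i + g i) ≡ ∑ n f + ∑ n g
∑-+ zero    f g = refl
∑-+ (suc n) f g = trans (cong (f 0 + g 0 +_) (∑-+ n (f ∘ suc) (g ∘ suc))) (interchange (f 0) (g 0) _ _)
  where
  interchange : ∀ a b c d → a + b + (c + d) ≡ a + c + (b + d)
  interchange = solve-∀

∑-* : ∀ n a f → ∑ n (λ i → a * f i) ≡ a * ∑ n f
∑-* zero    a f = sym (*-zeroʳ a)
∑-* (suc n) a f = trans (cong (a * f 0 +_) (∑-* n a (f ∘ suc))) (sym (*-distribˡ-+ a (f 0) _))

∑-0 : ∀ n → ∑ n (λ _ → 0) ≡ 0
∑-0 zero    = refl
∑-0 (suc n) = ∑-0 n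

∑-const : ∀ n a → ∑ n (λ _ → a) ≡ n * a
∑-const zero    a = refl
∑-const (suc n) a = cong (a +_) (∑-const n a)

∑-swap : ∀ n m (f : ℕ → ℕ → ℕ) → ∑ n (λ i → ∑ m (f i)) ≡ ∑ m (λ j → ∑ n (λ i → f i j))
∑-swap zero    m f = sym (∑-0 m)
∑-swap (suc n) m f = trans (cong (∑ m (f 0) +_) (∑-swap n m (f ∘ suc))) (sym (∑-+ m (f 0) _))

∑-at : ∀ {n a} f → a < n → (∀ i → i < n → i ≢ a → f i ≡ 0) → ∑ n f ≡ f a
∑-at {suc n} {zero}  f _         f≡0 = trans
  (cong (f 0 +_) (trans (∑-cong< n λ i i<n → f≡0 (suc i) (s≤s i<n) λ ()) (∑-0 n)))
  (+-identityʳ _)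
∑-at {suc n} {suc a} f (s≤s a<n) f≡0 = trans
  (cong (_+ ∑ n (f ∘ suc)) (f≡0 0 (s≤s z≤n) λ ()))
  (∑-at (f ∘ suc) a<n λ i i<n i≢a → f≡0 (suc i) (s≤s i<n) (i≢a ∘ suc-injective))

∑-δ : ∀ {n a} (f : ℕ → ℕ) → a < n → ∑ n (λ i → f i * δ i a) ≡ f a
∑-δ {n} {a} f a<n = trans
  (∑-at (λ i → f i * δ i a) a<n λ i _ i≢a → trans (cong (f i *_) (δ-≢ {i} {a} i≢a)) (*-zeroʳ (f i)))
  (trans (cong (f a *_) (δ-≡ {a} refl)) (*-identityʳ _))

∑δ≡1 : ∀ {n a} → a < n → ∑ n (λ i → δ i a) ≡ 1
∑δ≡1 {n} a<n = trans (∑-cong n λ i → sym (*-identityˡ _)) (∑-δ (λ _ → 1) a<n)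

∑-++ : ∀ a b f → ∑ (a + b) f ≡ ∑ a f + ∑ b (λ i → f (a + i))
∑-++ zero    b f = refl
∑-++ (suc a) b f = trans (cong (f 0 +_) (∑-++ a b (f ∘ suc))) (sym (+-assoc (f 0) _ _))

∑-blocks : ∀ m n f → ∑ (m * n) f ≡ ∑ m (λ ρ → ∑ n (λ i → f (ρ * n + i)))
∑-blocks zero    n f = refl
∑-blocks (suc m) n f = trans (∑-++ n (m * n) f) (cong (∑ n f +_)
  (trans (∑-blocks m n (λ i → f (n + i)))
         (∑-cong m λ ρ → ∑-cong n λ i → cong f (sym (+-assoc n (ρ * n) i)))))

-- Raising `a` by one moves the first entry to the end, since by periodicity the new last entry
-- equals the old first one.
rotate-↭ : ∀ {n} a f → Periodic n f → applyUpTo (λ i → f (a + i)) n ↭ applyUpTo f n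
rotate-↭ {zero}  a       f per = ↭-refl
rotate-↭ {suc n} zero    f per = ↭-refl
rotate-↭ {suc n} (suc a) f per = ↭-trans
  (↭-reflexive (trans
    (sym (applyUpTo-∷ʳ (λ i → f (suc a + i)) n))
    (cong₂ _∷ʳ_ (applyUpTo-cong n λ i _ → cong f (sym (+-suc a i)))
      (trans (cong f (sym (+-suc a n))) (trans (per a) (cong f (sym (+-identityʳ a))))))))
  (↭-trans (↭-sym (∷↭∷ʳ (f (a + 0)) (applyUpTo (λ i → f (a + suc i)) n))) (rotate-↭ a f per))

∑-shift : ∀ {n} a f → Periodic n f → ∑ n (λ i → f (i + a)) ≡ ∑ n f
∑-shift {n} a f per = trans (∑-cong n λ i → cong f (+-comm i a)) (sum-↭ (rotate-↭ a f per))

-- Residues modulo n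

module _ {n : ℕ} .{{_ : NonZero n}} where

  %-cong-+ʳ : ∀ {x y} z → x % n ≡ y % n → (x + z) % n ≡ (y + z) % n
  %-cong-+ʳ {x} {y} z eq = trans (%-distribˡ-+ x z n)
    (trans (cong (λ w → (w + z % n) % n) eq) (sym (%-distribˡ-+ y z n)))

  %-periodic : ∀ f → Periodic n (λ x → f (x % n))
  %-periodic f x = cong f ([m+n]%n≡m%n x n)

  -- Adding `x * n ∸ x` undoes the addition of `x` modulo `n` without leaving the natural numbers.
  %-cancel : ∀ x {u v} → u < n → v < n → (x + u) % n ≡ (x + v) % n → u ≡ v
  %-cancel x {u} {v} u<n v<n eq = trans (recover u u<n) (trans (%-cong-+ʳ (x * n ∸ x) eq) (sym (recover v v<n)))
    where
    x≤x*n : x ≤ x * n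
    x≤x*n = m≤m*n x n
    recover : ∀ w → w < n → w ≡ (x + w + (x * n ∸ x)) % n
    recover w w<n = begin
      w                            ≡⟨ m<n⇒m%n≡m w<n ⟨
      w % n                        ≡⟨ [m+kn]%n≡m%n w x n ⟨
      (w + x * n) % n              ≡⟨ cong (λ y → (w + y) % n) (m+[n∸m]≡n x≤x*n) ⟨
      (w + (x + (x * n ∸ x))) % n  ≡⟨ cong (_% n) (rearrange w x _) ⟩
      (x + w + (x * n ∸ x)) % n    ∎
      where
      open ≡-Reasoning
      rearrange : ∀ a b c → a + (b + c) ≡ b + a + c
      rearrange = solve-∀

  -- As `n` divides `p`, `p ∸ u` stands for minus `u`. Going back `u` steps lowers a residue by `u`,
  -- and `a + u < n` excludes a wrap-around.
  δ-%-∸ : ∀ {p} x {a u} → n ∣ p → u ≤ p → a + u < n → δ ((x + (p ∸ u)) % n) a ≡ δ (x % n) (a + u)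
  δ-%-∸ {p} x {a} {u} n∣p u≤p a+u<n = δ-iff to from
    where
    open ≡-Reasoning
    a<n : a < n
    a<n = ≤-<-trans (m≤m+n a u) a+u<n
    to : (x + (p ∸ u)) % n ≡ a → x % n ≡ a + u
    to eq = begin
      x % n                  ≡⟨ %-remove-+ʳ x n∣p ⟨
      (x + p) % n            ≡⟨ cong (λ y → (x + y) % n) (m∸n+n≡m u≤p) ⟨
      (x + (p ∸ u + u)) % n  ≡⟨ cong (_% n) (+-assoc x _ u) ⟨
      (x + (p ∸ u) + u) % n  ≡⟨ %-cong-+ʳ u (trans eq (sym (m<n⇒m%n≡m a<n))) ⟩
      (a + u) % n            ≡⟨ m<n⇒m%n≡m a+u<n ⟩
      a + u                  ∎
    from : x % n ≡ a + u → (x + (p ∸ u)) % n ≡ a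
    from eq = begin
      (x + (p ∸ u)) % n      ≡⟨ %-cong-+ʳ (p ∸ u) (trans eq (sym (m<n⇒m%n≡m a+u<n))) ⟩
      (a + u + (p ∸ u)) % n  ≡⟨ cong (_% n) (+-assoc a u _) ⟩
      (a + (u + (p ∸ u))) % n ≡⟨ cong (λ y → (a + y) % n) (m+[n∸m]≡n u≤p) ⟩
      (a + p) % n            ≡⟨ %-remove-+ʳ a n∣p ⟩
      a % n                  ≡⟨ m<n⇒m%n≡m a<n ⟩
      a                      ∎

  -- Each of the `m` blocks of `n` consecutive times runs through every residue once, whatever the
  -- offset `c`.
  ∑-residues : ∀ m c f → ∑ (m * n) (λ τ → f ((τ + c) % n)) ≡ m * ∑ n f
  ∑-residues m c f = begin
    ∑ (m * n) (λ τ → f ((τ + c) % n))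
      ≡⟨ ∑-blocks m n _ ⟩
    ∑ m (λ ρ → ∑ n (λ i → f ((ρ * n + i + c) % n)))
      ≡⟨ ∑-cong m (λ ρ → trans (∑-cong n λ i → cong f (drop-block ρ i)) (∑-shift c (f ∘ (_% n)) (%-periodic f))) ⟩
    ∑ m (λ _ → ∑ n (λ i → f (i % n)))
      ≡⟨ ∑-const m _ ⟩
    m * ∑ n (λ i → f (i % n))
      ≡⟨ cong (m *_) (∑-cong< n λ i i<n → cong f (m<n⇒m%n≡m i<n)) ⟩
    m * ∑ n f ∎
    where
    open ≡-Reasoning
    drop-block : ∀ ρ i → (ρ * n + i + c) % n ≡ (i + c) % n
    drop-block ρ i = trans (cong (_% n) (+-assoc (ρ * n) i c)) (%-remove-+ˡ (i + c) (n∣m*n ρ))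

-- Counting the vertices alive at a given time

module _ {p : ℕ} .{{_ : NonZero p}} where

  toℕ-mod-+ : ∀ τ u → toℕ ((toℕ (τ mod p) + u) mod p) ≡ (τ + u) % p
  toℕ-mod-+ τ u = trans (toℕ-fromℕ< _) (%-cong-+ʳ {x = toℕ (τ mod p)} {τ} u
    (trans (cong (_% p) (toℕ-fromℕ< _)) (m%n%n≡m%n τ p)))

  -- Because `l ≤ p`, the times of an arc are distinct modulo `p`, so at most one summand is 1.
  arcIndicator : ∀ {l} t τ → l ≤ p →
    bit (does (t ∈? window l (τ mod p))) ≡ ∑ l (λ u → δ ((τ + u) % p) (toℕ t))
  arcIndicator {l} t τ l≤p with t ∈? window l (τ mod p)
  ... | yes t∈ with u , u<l , refl ← ∈-window⁻ (τ mod p) t∈ = sym (trans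
          (∑-at _ u<l λ i i<l i≢u → δ-≢ λ eq →
            i≢u (%-cancel τ (<-≤-trans i<l l≤p) (<-≤-trans u<l l≤p) (trans eq (toℕ-mod-+ τ u))))
          (δ-≡ (sym (toℕ-mod-+ τ u))))
  ... | no  t∉ = sym (trans
          (∑-cong< l λ u u<l → δ-≢ λ eq → t∉ (subst (_∈ window l (τ mod p))
            (toℕ-injective (trans (toℕ-mod-+ τ u) eq)) (∈-window⁺ (τ mod p) u<l)))
          (∑-0 l))

  ∑-δ-% : ∀ {t} u f → Periodic p f → t < p → u ≤ p → ∑ p (λ τ → f τ * δ ((τ + u) % p) t) ≡ f (t + (p ∸ u))
  ∑-δ-% {t} u f per t<p u≤p = begin
    ∑ p (λ τ → f τ * δ ((τ + u) % p) t)
      ≡⟨ ∑-cong p (λ τ → cong (_* δ ((τ + u) % p) t) (sym (trans (cong f (back τ)) (per τ)))) ⟩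
    ∑ p (λ τ → g (τ + u))
      ≡⟨ ∑-shift u g (λ x → cong₂ _*_
           (trans (cong f (m+n+o≡m+o+n x p (p ∸ u))) (per (x + (p ∸ u))))
           (cong (λ y → δ y t) ([m+n]%n≡m%n x p))) ⟩
    ∑ p g
      ≡⟨ ∑-cong< p (λ τ τ<p → cong (λ y → f (τ + (p ∸ u)) * δ y t) (m<n⇒m%n≡m τ<p)) ⟩
    ∑ p (λ τ → f (τ + (p ∸ u)) * δ τ t)
      ≡⟨ ∑-δ (λ τ → f (τ + (p ∸ u))) t<p ⟩
    f (t + (p ∸ u)) ∎
    where
    open ≡-Reasoning
    g : ℕ → ℕ
    g x = f (x + (p ∸ u)) * δ (x % p) t
    back : ∀ τ → τ + u + (p ∸ u) ≡ τ + p
    back τ = trans (+-assoc τ u _) (cong (τ +_) (m+[n∸m]≡n u≤p))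

  -- Double counting: a vertex of lifespan `l` is alive at `t` if and only if it started `u` steps
  -- earlier for some `u < l`, so the sum over starting times becomes a sum over `u`.
  ∑-arcs : ∀ {l} t f → Periodic p f → l ≤ p →
    ∑ p (λ τ → f τ * bit (does (t ∈? window l (τ mod p)))) ≡ ∑ l (λ u → f (toℕ t + (p ∸ u)))
  ∑-arcs {l} t f per l≤p = begin
    ∑ p (λ τ → f τ * bit (does (t ∈? window l (τ mod p))))
      ≡⟨ ∑-cong p (λ τ → trans (cong (f τ *_) (arcIndicator t τ l≤p)) (sym (∑-* l (f τ) _))) ⟩
    ∑ p (λ τ → ∑ l (λ u → f τ * δ ((τ + u) % p) (toℕ t)))
      ≡⟨ ∑-swap p l _ ⟩
    ∑ l (λ u → ∑ p (λ τ → f τ * δ ((τ + u) % p) (toℕ t)))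
      ≡⟨ ∑-cong< l (λ u u<l → ∑-δ-% u f per (toℕ<n t) (≤-trans (<⇒≤ u<l) l≤p)) ⟩
    ∑ l (λ u → f (toℕ t + (p ∸ u))) ∎
    where open ≡-Reasoning

  copies : (N : ℕ → ℕ) (l τ : ℕ) → List (Label p)
  copies N l τ = replicate (N τ) (τ mod p , l)

  -- `A`, `P` and `S` count the vertices starting at a time: anchors of lifespan `k`, vertices
  -- shared by a pair of edges, and single-use vertices.
  starting : (A P S : ℕ → ℕ) → ℕ → ℕ → List (Label p)
  starting A P S k τ = copies A k τ ++ copies P 2 τ ++ copies S 1 τ

  allStarting : (A P S : ℕ → ℕ) → ℕ → List (Label p)
  allStarting A P S k = concat (applyUpTo (starting A P S k) p)

  tally-++ : ∀ t xs ys → tally {p} t (xs ++ ys) ≡ tally t xs + tally t ys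
  tally-++ t xs ys = trans (cong sum (map-++ _ xs ys)) (sum-++ (map _ xs) _)

  tally-concat : ∀ t (f : ℕ → List (Label p)) n → tally t (concat (applyUpTo f n)) ≡ ∑ n (tally t ∘ f)
  tally-concat t f zero    = refl
  tally-concat t f (suc n) = trans (tally-++ t (f 0) _) (cong (tally t (f 0) +_) (tally-concat t (f ∘ suc) n))

  tally-replicate : ∀ t a x → tally {p} t (replicate a x) ≡ a * bit (does (t ∈? arc x))
  tally-replicate t zero    x = refl
  tally-replicate t (suc a) x = cong (bit (does (t ∈? arc x)) +_) (tally-replicate t a x)

  length-concat : ∀ (f : ℕ → List (Label p)) n → length (concat (applyUpTo f n)) ≡ ∑ n (length ∘ f)
  length-concat f zero    = refl
  length-concat f (suc n) = trans (length-++ (f 0)) (cong (length (f 0) +_) (length-concat (f ∘ suc) n))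

  length-allStarting : ∀ A P S k → length (allStarting A P S k) ≡ ∑ p A + (∑ p P + ∑ p S)
  length-allStarting A P S k = begin
    length (allStarting A P S k)        ≡⟨ length-concat (starting A P S k) p ⟩
    ∑ p (length ∘ starting A P S k)     ≡⟨ ∑-cong p each ⟩
    ∑ p (λ τ → A τ + (P τ + S τ))       ≡⟨ ∑-+ p A _ ⟩
    ∑ p A + ∑ p (λ τ → P τ + S τ)       ≡⟨ cong (∑ p A +_) (∑-+ p P S) ⟩
    ∑ p A + (∑ p P + ∑ p S)             ∎
    where
    open ≡-Reasoning
    each : ∀ τ → length (starting A P S k τ) ≡ A τ + (P τ + S τ)
    each τ = trans (length-++ (copies A k τ)) (cong₂ _+_ (length-replicate (A τ))
      (trans (length-++ (copies P 2 τ)) (cong₂ _+_ (length-replicate (P τ)) (length-replicate (S τ)))))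

  tally-allStarting : ∀ A P S {k} → Periodic p A → Periodic p P → Periodic p S → k ≤ p → 2 ≤ p → ∀ t →
    tally t (allStarting A P S k) ≡
    ∑ k (λ u → A (toℕ t + (p ∸ u))) + ((P (toℕ t) + P (toℕ t + (p ∸ 1))) + S (toℕ t))
  tally-allStarting A P S {k} perA perP perS k≤p 2≤p t = begin
    tally t (allStarting A P S k)
      ≡⟨ tally-concat t (starting A P S k) p ⟩
    ∑ p (tally t ∘ starting A P S k)
      ≡⟨ ∑-cong p each ⟩
    ∑ p (λ τ → A τ * I k τ + (P τ * I 2 τ + S τ * I 1 τ))
      ≡⟨ trans (∑-+ p (λ τ → A τ * I k τ) _) (cong (∑ p (λ τ → A τ * I k τ) +_) (∑-+ p (λ τ → P τ * I 2 τ) _)) ⟩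
    ∑ p (λ τ → A τ * I k τ) + (∑ p (λ τ → P τ * I 2 τ) + ∑ p (λ τ → S τ * I 1 τ))
      ≡⟨ cong₂ _+_ (∑-arcs t A perA k≤p) (cong₂ _+_ (∑-arcs t P perP 2≤p) (∑-arcs t S perS (≤-trans (n≤1+n 1) 2≤p))) ⟩
    -- The terms with `u = 0` appear at time `t + p`; periodicity brings them back to `t`.
    _ ≡⟨ cong (∑ k (λ u → A (toℕ t + (p ∸ u))) +_)
           (cong₂ _+_ (cong₂ _+_ (perP _) (+-identityʳ _)) (trans (+-identityʳ _) (perS _))) ⟩
    _ ∎
    where
    open ≡-Reasoning
    I : ℕ → ℕ → ℕ
    I l τ = bit (does (t ∈? window l (τ mod p)))
    each : ∀ τ → tally t (starting A P S k τ) ≡ A τ * I k τ + (P τ * I 2 τ + S τ * I 1 τ)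
    each τ = trans (tally-++ t (copies A k τ) _) (cong₂ _+_ (tally-replicate t (A τ) _)
      (trans (tally-++ t (copies P 2 τ) _) (cong₂ _+_ (tally-replicate t (P τ) _) (tally-replicate t (S τ) _))))

  bounds-allStarting : ∀ A P S {k} → 2 ≤ k → All (λ x → 1 ≤ proj₂ x × proj₂ x ≤ k) (allStarting A P S k)
  bounds-allStarting A P S {k} 2≤k = All.concat⁺ (All.applyUpTo⁺₂ (starting A P S k) p λ τ →
    All.++⁺ (All.replicate⁺ (A τ) (1≤k , ≤-refl))
      (All.++⁺ (All.replicate⁺ (P τ) (s≤s z≤n , 2≤k)) (All.replicate⁺ (S τ) (≤-refl , 1≤k))))
    where
    1≤k : 1 ≤ k
    1≤k = ≤-trans (n≤1+n 1) 2≤k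

-- Schedules: labels from prescribed class sizes at each age

tabulate-toℕ : ∀ {A : Set} (f : ℕ → A) n → List.tabulate {n = n} (f ∘ toℕ) ≡ applyUpTo f n
tabulate-toℕ f zero    = refl
tabulate-toℕ f (suc n) = cong (f 0 ∷_) (tabulate-toℕ (f ∘ suc) n)

∑δ-≤ : ∀ k {n} → k ≤ n → ∑ n (λ j → ∑ k (δ j)) ≡ k
∑δ-≤ k {n} k≤n = begin
  ∑ n (λ j → ∑ k (δ j))        ≡⟨ ∑-swap n k δ ⟩
  ∑ k (λ u → ∑ n (λ j → δ j u)) ≡⟨ ∑-cong< k (λ u u<k → ∑δ≡1 (<-≤-trans u<k k≤n)) ⟩
  ∑ k (λ _ → 1)                ≡⟨ ∑-const k 1 ⟩
  k * 1                        ≡⟨ *-identityʳ k ⟩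
  k                            ∎
  where open ≡-Reasoning

-- At time t the class c meets e_t in B t j vertices, where j = (t + c) mod n is
-- the age of its current visit.  A visit opens with one vertex kept for k
-- edges; at age j₀ it takes π t vertices kept for two edges; the remaining
-- vertices are used once.
schedule : ∀ {k m n q r ρ j₀} .{{_ : NonZero n}} .{{_ : NonZero m}}
  (σ : Partition r) (B : ℕ → ℕ → ℕ) (π : ℕ → ℕ) →
  2 ≤ k → k < n → suc j₀ < n →
  (∀ j → Periodic (m * n) (λ t → B t j)) → Periodic (m * n) π →
  (∀ t j → ∑ k (δ j) + (π t * δ j j₀ + π (t + (m * n ∸ 1)) * δ j (suc j₀)) ≤ B t j) →
  (∀ t → filter (0 <?_) (applyUpTo (B t) n) ↭ parts σ) →
  (∀ c → ∑ (m * n) (λ t → B t ((t + c) % n)) ≡ m * r) →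
  (∀ c → ∑ (m * n) (λ t → π t * δ ((t + c) % n) j₀) ≡ ρ) →
  q + ρ + m * k ≡ m * r + m →
  HasIntersectingHamiltonianCycle (σ-hypergraph n q σ) k
schedule {k} {m} {n} {q} {r} {ρ} {j₀} σ B π 2≤k k<n j₀+1<n perB perπ room profile ∑B ∑π balance =
  labelled-cycle σ labels (≤-trans (n≤1+n 1) 2≤k) lengths (λ c → bounds-allStarting (A c) (P c) (S c) 2≤k) anchors profile′
  where
  open ≡-Reasoning
  p : ℕ
  p = m * n
  instance
    p≢0 : NonZero p
    p≢0 = m*n≢0 m n

  n≤p : n ≤ p
  n≤p = m≤n*m n m

  age : Fin n → ℕ → ℕ
  age c t = (t + toℕ c) % n

  A P S : Fin n → ℕ → ℕ
  A c t = δ (age c t) 0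
  P c t = π t * δ (age c t) j₀
  -- The single-use vertices fill up what `B` still asks for; by `fits` the truncated subtraction is
  -- exact.
  S c t = B t (age c t) ∸ (∑ k (δ (age c t)) + (P c t + P c (t + (p ∸ 1))))

  labels : Fin n → List (Label p)
  labels c = allStarting (A c) (P c) (S c) k

  age-periodic : ∀ c → Periodic p (age c)
  age-periodic c t = trans (cong (_% n) (m+n+o≡m+o+n t p (toℕ c))) (%-remove-+ʳ (t + toℕ c) (n∣m*n m))

  age-earlier : ∀ c t {a u} → u ≤ p → a + u < n → δ (age c (t + (p ∸ u))) a ≡ δ (age c t) (a + u)
  age-earlier c t {a} {u} u≤p a+u<n = trans
    (cong (λ x → δ (x % n) a) (m+n+o≡m+o+n t (p ∸ u) (toℕ c)))
    (δ-%-∸ (t + toℕ c) (n∣m*n m) u≤p a+u<n)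

  perA : ∀ c → Periodic p (A c)
  perA c t = cong (λ x → δ x 0) (age-periodic c t)

  perP : ∀ c → Periodic p (P c)
  perP c t = cong₂ (λ x y → x * δ y j₀) (perπ t) (age-periodic c t)

  perS : ∀ c → Periodic p (S c)
  perS c t = cong₂ _∸_
    (trans (perB _ t) (cong (B t) (age-periodic c t)))
    (cong₂ _+_ (cong (λ j → ∑ k (δ j)) (age-periodic c t))
      (cong₂ _+_ (perP c t) (trans (cong (P c) (m+n+o≡m+o+n t p (p ∸ 1))) (perP c _))))

  P-earlier : ∀ c t → P c (t + (p ∸ 1)) ≡ π (t + (p ∸ 1)) * δ (age c t) (suc j₀)
  P-earlier c t = cong (π (t + (p ∸ 1)) *_) (trans
    (age-earlier c t (≤-trans (≤-trans (s≤s z≤n) j₀+1<n) n≤p) (subst (_< n) (+-comm 1 j₀) j₀+1<n))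
    (cong (δ (age c t)) (+-comm j₀ 1)))

  fits : ∀ c t → ∑ k (δ (age c t)) + (P c t + P c (t + (p ∸ 1))) ≤ B t (age c t)
  fits c t = subst (λ x → ∑ k (δ (age c t)) + (P c t + x) ≤ B t (age c t)) (sym (P-earlier c t)) (room t (age c t))

  tally≡B : ∀ c t → tally t (labels c) ≡ B (toℕ t) (age c (toℕ t))
  tally≡B c t = begin
    tally t (labels c)
      ≡⟨ tally-allStarting (A c) (P c) (S c) (perA c) (perP c) (perS c) (≤-trans (<⇒≤ k<n) n≤p) (≤-trans (≤-trans 2≤k (<⇒≤ k<n)) n≤p) t ⟩
    ∑ k (λ u → A c (toℕ t + (p ∸ u))) + ((P c (toℕ t) + P c (toℕ t + (p ∸ 1))) + S c (toℕ t))
      ≡⟨ cong (_+ ((P c (toℕ t) + P c (toℕ t + (p ∸ 1))) + S c (toℕ t)))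
           (∑-cong< k λ u u<k → age-earlier c (toℕ t) (≤-trans (<⇒≤ (<-trans u<k k<n)) n≤p) (<-trans u<k k<n)) ⟩
    ∑ k (δ (age c (toℕ t))) + ((P c (toℕ t) + P c (toℕ t + (p ∸ 1))) + S c (toℕ t))
      ≡⟨ +-assoc (∑ k (δ (age c (toℕ t)))) _ _ ⟨
    (∑ k (δ (age c (toℕ t))) + (P c (toℕ t) + P c (toℕ t + (p ∸ 1)))) + S c (toℕ t)
      ≡⟨ m+[n∸m]≡n (fits c (toℕ t)) ⟩
    B (toℕ t) (age c (toℕ t)) ∎

  -- As `c` runs through the classes, the ages at time `t` run through `0 , … , n - 1` in rotated
  -- order.
  profile′ : ∀ t → filter (0 <?_) (map (λ c → tally t (labels c)) (allFin n)) ↭ parts σ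
  profile′ t = ↭-trans (filter-↭ (0 <?_) (↭-trans (↭-reflexive reindex)
      (rotate-↭ (toℕ t) (λ x → B (toℕ t) (x % n)) (%-periodic (B (toℕ t))))))
    (↭-trans (↭-reflexive (cong (filter (0 <?_)) (applyUpTo-cong n λ i i<n → cong (B (toℕ t)) (m<n⇒m%n≡m i<n)))) (profile (toℕ t)))
    where
    reindex : map (λ c → tally t (labels c)) (allFin n) ≡ applyUpTo (λ i → B (toℕ t) ((toℕ t + i) % n)) n
    reindex = trans (map-tabulate id (λ c → tally t (labels c)))
      (trans (tabulate-cong λ c → tally≡B c t) (tabulate-toℕ (λ i → B (toℕ t) ((toℕ t + i) % n)) n))

  -- Counting incidences of class `c` with the edges gives `m * k + 2 * ρ + ∑ p (S c) = m * r`,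
  -- while the class has `m + ρ + ∑ p (S c)` vertices; `balance` says that this number is `q`.
  lengths : ∀ c → length (labels c) ≡ q
  lengths c = trans (length-allStarting {p} (A c) (P c) (S c) k)
    (+-cancelʳ-≡ (ρ + m * k) _ _ (begin
      ∑ p (A c) + (∑ p (P c) + ∑ p (S c)) + (ρ + m * k)
        ≡⟨ cong₂ (λ a b → a + (b + ∑ p (S c)) + (ρ + m * k)) ∑A (∑π (toℕ c)) ⟩
      m + (ρ + ∑ p (S c)) + (ρ + m * k)
        ≡⟨ rearrange m ρ (∑ p (S c)) (m * k) ⟩
      ((m * k + (ρ + ρ)) + ∑ p (S c)) + m
        ≡⟨ cong (_+ m) ∑S ⟩
      m * r + m
        ≡⟨ balance ⟨
      q + ρ + m * k
        ≡⟨ +-assoc q ρ _ ⟩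
      q + (ρ + m * k) ∎))
    where
    rearrange : ∀ m ρ s x → m + (ρ + s) + (ρ + x) ≡ ((x + (ρ + ρ)) + s) + m
    rearrange = solve-∀
    ∑A : ∑ p (A c) ≡ m
    ∑A = trans (∑-residues m (toℕ c) (λ j → δ j 0))
      (trans (cong (m *_) (∑δ≡1 (≤-trans (s≤s z≤n) j₀+1<n))) (*-identityʳ m))
    ∑S : (m * k + (ρ + ρ)) + ∑ p (S c) ≡ m * r
    ∑S = begin
      (m * k + (ρ + ρ)) + ∑ p (S c)
        ≡⟨ cong (_+ ∑ p (S c)) (cong₂ _+_
             (trans (∑-residues m (toℕ c) (λ j → ∑ k (δ j))) (cong (m *_) (∑δ-≤ k (<⇒≤ k<n))))
             (cong₂ _+_ (∑π (toℕ c)) (trans (∑-shift (p ∸ 1) (P c) (perP c)) (∑π (toℕ c))))) ⟨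
      (∑ p (λ t → ∑ k (δ (age c t))) + (∑ p (P c) + ∑ p (λ t → P c (t + (p ∸ 1))))) + ∑ p (S c)
        ≡⟨ cong (_+ ∑ p (S c)) (cong (∑ p (λ t → ∑ k (δ (age c t))) +_) (∑-+ p (P c) _)) ⟨
      (∑ p (λ t → ∑ k (δ (age c t))) + ∑ p (λ t → P c t + P c (t + (p ∸ 1)))) + ∑ p (S c)
        ≡⟨ cong (_+ ∑ p (S c)) (∑-+ p (λ t → ∑ k (δ (age c t))) _) ⟨
      ∑ p (λ t → ∑ k (δ (age c t)) + (P c t + P c (t + (p ∸ 1)))) + ∑ p (S c)
        ≡⟨ ∑-+ p _ (S c) ⟨
      ∑ p (λ t → (∑ k (δ (age c t)) + (P c t + P c (t + (p ∸ 1)))) + S c t)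
        ≡⟨ ∑-cong p (λ t → m+[n∸m]≡n (fits c t)) ⟩
      ∑ p (λ t → B t (age c t))
        ≡⟨ ∑B (toℕ c) ⟩
      m * r ∎

  anchors : ∀ τ → ∃[ c ] (τ , k) ∈ˡ labels c
  anchors τ = c , ∈-concat⁺′ (∈-++⁺ˡ τ∈) (∈-applyUpTo⁺ (starting (A c) (P c) (S c) k) (toℕ<n τ))
    where
    c : Fin n
    -- Since `n ∸ 1` is minus 1 modulo `n`, this is the class whose age at time `τ` is 0.
    c = (toℕ τ * (n ∸ 1)) mod n
    age≡0 : age c (toℕ τ) ≡ 0
    age≡0 = begin
      (toℕ τ + toℕ c) % n                       ≡⟨ cong (λ x → (toℕ τ + x) % n) (toℕ-fromℕ< _) ⟩
      (toℕ τ + toℕ τ * (n ∸ 1) % n) % n         ≡⟨ cong (_% n) (+-comm (toℕ τ) _) ⟩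
      (toℕ τ * (n ∸ 1) % n + toℕ τ) % n         ≡⟨ %-cong-+ʳ {x = toℕ τ * (n ∸ 1) % n} (toℕ τ) (m%n%n≡m%n (toℕ τ * (n ∸ 1)) n) ⟩
      (toℕ τ * (n ∸ 1) + toℕ τ) % n             ≡⟨ cong (_% n) (trans (+-comm _ (toℕ τ)) (sym (*-suc (toℕ τ) (n ∸ 1)))) ⟩
      (toℕ τ * suc (n ∸ 1)) % n                 ≡⟨ cong (λ x → (toℕ τ * x) % n) (m+[n∸m]≡n (≤-trans (s≤s z≤n) j₀+1<n)) ⟩
      (toℕ τ * n) % n                           ≡⟨ m*n%n≡0 (toℕ τ) n ⟩
      0                                         ∎
    τ∈ : (τ , k) ∈ˡ copies (A c) k (toℕ τ)
    τ∈ = subst₂ (λ a x → (τ , k) ∈ˡ replicate a (x , k)) (sym (δ-≡ age≡0))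
      (sym (toℕ-injective (trans (toℕ-fromℕ< _) (m<n⇒m%n≡m (toℕ<n τ))))) (here refl)

-- Times arranged in m rounds of n columns

∑δ≤1 : ∀ n a → ∑ n (δ a) ≤ 1
∑δ≤1 zero    a       = z≤n
∑δ≤1 (suc n) zero    = ≤-reflexive (cong suc (∑-0 n))
∑δ≤1 (suc n) (suc a) = ∑δ≤1 n a

δ≤1 : ∀ a b → δ a b ≤ 1
δ≤1 a b with a ≟ b
... | yes a≡b = ≤-reflexive (δ-≡ a≡b)
... | no  a≢b = ≤-trans (≤-reflexive (δ-≢ a≢b)) z≤n

module _ (n m : ℕ) .{{_ : NonZero n}} .{{_ : NonZero m}} where

  -- The row of `t` in an array with `m` rows and `n` columns, the column being `t % n`.
  round : ℕ → ℕ
  round t = (t / n) % m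

  [t+pn]/n : ∀ t p → (t + p * n) / n ≡ t / n + p
  [t+pn]/n t p = trans (+-distrib-/-∣ʳ t (n∣m*n p)) (cong (t / n +_) (m*n/n≡m p n))

  round-periodic : Periodic (m * n) round
  round-periodic t = trans (cong (_% m) ([t+pn]/n t m)) ([m+n]%n≡m%n (t / n) m)

  ∑-grid : ∀ (h : ℕ → ℕ → ℕ) → ∑ (m * n) (λ t → h (round t) (t % n)) ≡ ∑ m (λ a → ∑ n (h a))
  ∑-grid h = trans (∑-blocks m n _)
    (∑-cong< m λ a a<m → ∑-cong< n λ i i<n → cong₂ h (row a i a<m i<n)
      (trans (%-remove-+ˡ i (n∣m*n a)) (m<n⇒m%n≡m i<n)))
    where
    row : ∀ a i → a < m → i < n → round (a * n + i) ≡ a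
    row a i a<m i<n = trans (cong (_% m) (trans (cong (_/ n) (+-comm (a * n) i))
      (trans ([t+pn]/n i a) (cong (_+ a) (m<n⇒m/n≡0 i<n))))) (m<n⇒m%n≡m a<m)

  ∑-rotate : ∀ c f → ∑ n (λ i → f ((i + c) % n)) ≡ ∑ n f
  ∑-rotate c f = trans (∑-shift c (f ∘ (_% n)) (%-periodic f))
    (∑-cong< n λ i i<n → cong f (m<n⇒m%n≡m i<n))

  -- The factor `f` is constant along a column, so only the column totals of `w` matter. This counts
  -- events of a class at a given age when their times are chosen by round and column.
  ∑-weighted : ∀ (w : ℕ → ℕ → ℕ) W c f → (∀ i → i < n → ∑ m (λ a → w a i) ≡ W) →
    ∑ (m * n) (λ t → w (round t) (t % n) * f ((t + c) % n)) ≡ W * ∑ n f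
  ∑-weighted w W c f total = begin
    ∑ (m * n) (λ t → w (round t) (t % n) * f ((t + c) % n))
      ≡⟨ ∑-cong (m * n) (λ t → cong (λ x → w (round t) (t % n) * f x) (sym (%-cong-+ʳ {x = t % n} {t} c (m%n%n≡m%n t n)))) ⟩
    ∑ (m * n) (λ t → w (round t) (t % n) * f ((t % n + c) % n))
      ≡⟨ ∑-grid (λ a i → w a i * f ((i + c) % n)) ⟩
    ∑ m (λ a → ∑ n (λ i → w a i * f ((i + c) % n)))
      ≡⟨ ∑-swap m n _ ⟩
    ∑ n (λ i → ∑ m (λ a → w a i * f ((i + c) % n)))
      ≡⟨ ∑-cong< n (λ i i<n → trans (trans (∑-cong m λ a → *-comm (w a i) _) (∑-* m (f ((i + c) % n)) (λ a → w a i)))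
           (trans (cong (f ((i + c) % n) *_) (total i i<n)) (*-comm (f ((i + c) % n)) W))) ⟩
    ∑ n (λ i → W * f ((i + c) % n))
      ≡⟨ ∑-* n W _ ⟩
    W * ∑ n (λ i → f ((i + c) % n))
      ≡⟨ cong (W *_) (∑-rotate c f) ⟩
    W * ∑ n f ∎
    where open ≡-Reasoning

  -- ζ marks the even columns of round 0 and the odd columns of round 1: one time
  -- per residue mod n, no two of them consecutive if m ≥ 3.
  ζ : ℕ → ℕ
  ζ t = δ (round t) (t % n % 2)

  ζ≤1 : ∀ t → ζ t ≤ 1
  ζ≤1 t = δ≤1 (round t) (t % n % 2)

  ζ-periodic : Periodic (m * n) ζ
  ζ-periodic t = cong₂ (λ a i → δ a (i % 2)) (round-periodic t) (%-remove-+ʳ t (n∣m*n m))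

  -- With `2 ≤ m` rounds 0 and 1 both exist, and every column holds exactly one mark.
  ∑-ζ : ∀ c f → 2 ≤ m → ∑ (m * n) (λ t → ζ t * f ((t + c) % n)) ≡ ∑ n f
  ∑-ζ c f 2≤m = trans (∑-weighted (λ a i → δ a (i % 2)) 1 c f λ i _ → ∑δ≡1 (<-≤-trans (m%n<n i 2) 2≤m)) (*-identityˡ _)

  -- Inside a round, neighbouring columns have different parity, so one round number cannot match
  -- both. From the last column the round rises to 1 or 2, without wrapping as `3 ≤ m`, whereas a
  -- mark in column 0 requires round 0.
  ζ-sparse : ∀ t → 3 ≤ m → ζ t ≡ 0 ⊎ ζ (suc t) ≡ 0
  ζ-sparse t 3≤m with round t ≟ t % n % 2 | round (suc t) ≟ suc t % n % 2
  ... | no ≢ | _    = inj₁ (δ-≢ ≢)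
  ... | _    | no ≢ = inj₂ (δ-≢ ≢)
  ... | yes eq | yes eq′ = contradiction eq′ clash
    where
    1+t : suc t ≡ suc (t % n) + t / n * n
    1+t = cong suc (m≡m%n+[m/n]*n t n)
    parity : ∀ x → x % 2 ≢ suc x % 2
    parity zero ()
    parity (suc x) e = parity x (trans (sym (trans (cong (_% 2) (+-comm 2 x)) ([m+n]%n≡m%n x 2))) (sym e))
    clash : round (suc t) ≢ suc t % n % 2
    clash eq′ with m≤n⇒m<n∨m≡n (m%n<n t n)
    ... | inj₁ same = parity (t % n) (begin
            t % n % 2          ≡⟨ eq ⟨
            round t            ≡⟨ cong (_% m) sameRow ⟨
            round (suc t)      ≡⟨ eq′ ⟩
            suc t % n % 2      ≡⟨ cong (_% 2) nextColumn ⟩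
            suc (t % n) % 2    ∎)
      where
      open ≡-Reasoning
      sameRow : suc t / n ≡ t / n
      sameRow = trans (cong (_/ n) 1+t) (trans ([t+pn]/n (suc (t % n)) (t / n)) (cong (_+ t / n) (m<n⇒m/n≡0 same)))
      nextColumn : suc t % n ≡ suc (t % n)
      nextColumn = trans (cong (_% n) 1+t) (trans ([m+kn]%n≡m%n (suc (t % n)) (t / n) n) (m<n⇒m%n≡m same))
    ... | inj₂ last = 0≢1+n (sym (begin
            suc (round t)          ≡⟨ m<n⇒m%n≡m (≤-trans (s≤s (s≤s (≤-reflexive eq))) (≤-trans (s≤s (m%n<n (t % n) 2)) 3≤m)) ⟨
            suc (round t) % m      ≡⟨ cong (_% m) (+-comm 1 (round t)) ⟩
            (round t + 1) % m      ≡⟨ %-cong-+ʳ {x = round t} {t / n} 1 (m%n%n≡m%n (t / n) m) ⟩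
            (t / n + 1) % m        ≡⟨ cong (_% m) nextRow ⟨
            round (suc t)          ≡⟨ eq′ ⟩
            suc t % n % 2          ≡⟨ cong (_% 2) firstColumn ⟩
            0                      ∎))
      where
      open ≡-Reasoning
      1+t≡ : suc t ≡ 0 + suc (t / n) * n
      1+t≡ = trans 1+t (cong (_+ t / n * n) last)
      nextRow : suc t / n ≡ t / n + 1
      nextRow = trans (cong (_/ n) 1+t≡) (trans (m*n/n≡m (suc (t / n)) n) (+-comm 1 (t / n)))
      firstColumn : suc t % n ≡ 0
      firstColumn = trans (cong (_% n) 1+t≡) (m*n%n≡0 (suc (t / n)) n)

-- Reading the parts of σ off the ages

nth : List ℕ → ℕ → ℕ
-- The default 0 makes a class idle once all parts have been used.
nth []       _       = 0
nth (x ∷ xs) zero    = x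
nth (x ∷ xs) (suc i) = nth xs i

positives : List ℕ → List ℕ
positives = filter (0 <?_)

positives-∷ : ∀ x xs → positives (x ∷ xs) ≡ positives (x ∷ []) ++ positives xs
positives-∷ zero    xs = refl
positives-∷ (suc x) xs = refl

positives-zeros : ∀ n → positives (applyUpTo (λ _ → 0) n) ≡ []
positives-zeros zero    = refl
positives-zeros (suc n) = positives-zeros n

positives-nth : ∀ xs {n} → length xs ≤ n → positives (applyUpTo (nth xs) n) ≡ positives xs
positives-nth []           {n} _     = positives-zeros n
positives-nth (x ∷ xs) {suc n} (s≤s l≤n) = begin
  positives (x ∷ applyUpTo (nth xs) n)            ≡⟨ positives-∷ x _ ⟩
  positives (x ∷ []) ++ positives (applyUpTo (nth xs) n) ≡⟨ cong (positives (x ∷ []) ++_) (positives-nth xs l≤n) ⟩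
  positives (x ∷ []) ++ positives xs              ≡⟨ positives-∷ x xs ⟨
  positives (x ∷ xs)                              ∎
  where open ≡-Reasoning

∑-nth : ∀ xs {n} → length xs ≤ n → ∑ n (nth xs) ≡ sum xs
∑-nth []           {n} _     = ∑-0 n
∑-nth (x ∷ xs) {suc n} (s≤s l≤n) = cong (x +_) (∑-nth xs l≤n)

-- Each of the first `k` parts is positive, hence has room for the anchor.
∑δ≤nth : ∀ {k xs} j → All (0 <_) xs → k ≤ length xs → ∑ k (δ j) ≤ nth xs j
∑δ≤nth {zero}  j       _          _          = z≤n
∑δ≤nth {suc k} zero    (x>0 ∷ _)  _          = ≤-trans (≤-reflexive (cong suc (∑-0 k))) x>0
∑δ≤nth {suc k} (suc j) (_ ∷ xs>0) (s≤s k≤l)  = ∑δ≤nth j xs>0 k≤l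

-- The summand `g * 0` is what remains of `g * δ j a` once the induction has passed `a`.
positives-ones : ∀ {k n} g → k ≤ n → positives (applyUpTo (λ j → ∑ k (δ j) + g * 0) n) ≡ replicate k 1
positives-ones {zero}  {n} g _ = trans (cong positives (applyUpTo-cong n λ _ _ → *-zeroʳ g)) (positives-zeros n)
positives-ones {suc k} {suc n} g (s≤s k≤n)
  rewrite ∑-0 k | *-zeroʳ g = cong (1 ∷_) (trans (cong positives (applyUpTo-cong n λ j _ → cong (∑ k (δ j) +_) (sym (*-zeroʳ g)))) (positives-ones g k≤n))

-- The chunk falls on an age at which the anchor is alive and joins it in one part `suc g`; the
-- other ages of the anchor give parts 1.
profile-inner : ∀ {k a n} g → a ≤ k → suc k ≤ n →
  positives (applyUpTo (λ j → ∑ (suc k) (δ j) + g * δ j a) n) ↭ suc g ∷ replicate k 1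
profile-inner {k} {zero} {suc n} g _ (s≤s k≤n)
  rewrite ∑-0 k | *-identityʳ g = prep (suc g) (↭-reflexive (positives-ones g k≤n))
profile-inner {suc k} {suc a} {suc n} g (s≤s a≤k) (s≤s k<n)
  rewrite ∑-0 k | *-zeroʳ g = ↭-trans (prep 1 (profile-inner g a≤k k<n)) (swap 1 (suc g) ↭-refl)

-- The chunk falls on an age after the anchor has ended and forms a part of its own.
profile-outer : ∀ {k a n} g → k ≤ a → a < n →
  positives (applyUpTo (λ j → ∑ k (δ j) + suc g * δ j a) n) ↭ suc g ∷ replicate k 1
profile-outer {zero} {zero} {suc n} g _ _
  rewrite *-identityʳ g = prep (suc g) (↭-reflexive (positives-ones {0} {n} (suc g) z≤n))
profile-outer {zero} {suc a} {suc n} g _ (s≤s a<n)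
  rewrite *-zeroʳ g = profile-outer g z≤n a<n
profile-outer {suc k} {suc a} {suc n} g (s≤s k≤a) (s≤s a<n)
  rewrite ∑-0 k | *-zeroʳ g = ↭-trans (prep 1 (profile-outer g k≤a a<n)) (swap 1 (suc g) ↭-refl)

-- Two schedules: fixed parts, and a travelling chunk

steady : ∀ {k m n q r ρ j₀ bs} .{{_ : NonZero n}} .{{_ : NonZero m}} (σ : Partition r) →
  2 ≤ k → k < n → suc j₀ < n → bs ↭ parts σ → length bs ≤ n →
  (∀ j → ∑ k (δ j) + (δ j j₀ + δ j (suc j₀)) ≤ nth bs j) →
  ρ ≤ m → q + ρ + m * k ≡ m * r + m →
  HasIntersectingHamiltonianCycle (σ-hypergraph n q σ) k
steady {k} {m} {n} {q} {r} {ρ} {j₀} {bs} σ 2≤k k<n j₀+1<n bs↭ l≤n room ρ≤m balance =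
  schedule {m = m} {j₀ = j₀} σ (λ _ → nth bs) π 2≤k k<n j₀+1<n (λ _ _ → refl)
    (λ t → cong (λ a → ∑ ρ (δ a)) (round-periodic n m t))
    (λ t j → ≤-trans (+-monoʳ-≤ (∑ k (δ j)) (+-mono-≤ (shrink t (δ j j₀)) (shrink (t + (m * n ∸ 1)) (δ j (suc j₀))))) (room j))
    (λ _ → ↭-trans (↭-reflexive (positives-nth bs l≤n)) (↭-trans (filter-↭ (0 <?_) bs↭) (↭-reflexive (filter-all (0 <?_) (positive σ)))))
    (λ c → trans (∑-residues m c (nth bs)) (cong (m *_) (trans (∑-nth bs l≤n) (trans (sum-↭ bs↭) (sum≡r σ)))))
    (λ c → trans (∑-weighted n m (λ a _ → ∑ ρ (δ a)) ρ c (λ j → δ j j₀) (λ _ _ → ∑δ-≤ ρ ρ≤m))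
      (trans (cong (ρ *_) (∑δ≡1 (<-trans (n<1+n j₀) j₀+1<n))) (*-identityʳ ρ)))
    balance
  where
  π : ℕ → ℕ
  -- This is 1 in the rounds below `ρ` and 0 in the others, so `ρ` of the `m` visits of a class save
  -- one vertex each.
  π t = ∑ ρ (δ (round n m t))
  shrink : ∀ t x → π t * x ≤ x
  shrink t x = ≤-trans (*-monoˡ-≤ x (∑δ≤1 ρ (round n m t))) (≤-reflexive (*-identityˡ x))

-- The chunk of g vertices of a visit belongs to age j₀.  At a time t with
-- ζ t = 1 the chunk of the newer visit is dropped and the preceding visit, then
-- of age j₀ + 1, takes g vertices again, ρ of them kept from time t - 1.
travelling : ∀ {k m n q r ρ j₀ g} .{{_ : NonZero n}} .{{_ : NonZero m}} (σ : Partition r) →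
  2 ≤ k → k < n → suc j₀ < n → r ≡ k + g → ρ ≤ g → 2 ≤ m → ρ ≡ 0 ⊎ 3 ≤ m →
  (∀ i → i ≤ 1 → positives (applyUpTo (λ j → ∑ k (δ j) + g * δ j (j₀ + i)) n) ↭ parts σ) →
  q + ρ + m * k ≡ m * r + m →
  HasIntersectingHamiltonianCycle (σ-hypergraph n q σ) k
travelling {k} {m} {n} {q} {r} {ρ} {j₀} {g} σ 2≤k k<n j₀+1<n r≡k+g ρ≤g 2≤m sparse profile balance =
  schedule {m = m} {j₀ = j₀} σ B π 2≤k k<n j₀+1<n
    (λ j t → cong (λ z → ∑ k (δ j) + g * δ j (j₀ + z)) (ζ-periodic n m t))
    (λ t → cong (ρ *_) (ζ-periodic n m (suc t)))
    room (λ t → profile (z t) (ζ≤1 n m _)) ∑B ∑π balance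
  where
  open ≡-Reasoning
  p : ℕ
  p = m * n
  instance
    p≢0 : NonZero p
    p≢0 = m*n≢0 m n
  z : ℕ → ℕ
  z = ζ n m
  B : ℕ → ℕ → ℕ
  B t j = ∑ k (δ j) + g * δ j (j₀ + z t)
  π : ℕ → ℕ
  -- Vertices kept for two edges start one step before a marked time, hence the look-ahead.
  π t = ρ * z (suc t)

  π-earlier : ∀ t → π (t + (p ∸ 1)) ≡ ρ * z t
  π-earlier t = cong (ρ *_) (trans
    (cong z (trans (sym (+-suc t (p ∸ 1))) (cong (t +_) (suc-pred p))))
    (ζ-periodic n m t))

  -- Before a marked time the saved vertices sit in the chunk at age `j₀`, at the marked time in the
  -- chunk at age `j₀ + 1`. Unless `ρ` is 0, `t` and `t + 1` are not both marked, so only one of the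
  -- two demands occurs.
  shared : ∀ j z z′ → z ≤ 1 → z′ ≤ 1 → ρ ≡ 0 ⊎ (z ≡ 0 ⊎ z′ ≡ 0) →
    ρ * z′ * δ j j₀ + ρ * z * δ j (suc j₀) ≤ g * δ j (j₀ + z)
  shared j z z′ _ _ (inj₁ refl) = z≤n
  shared j .0 z′ _ z′≤1 (inj₂ (inj₁ refl)) rewrite *-zeroʳ ρ | +-identityʳ (ρ * z′ * δ j j₀) | +-identityʳ j₀ =
    *-monoˡ-≤ (δ j j₀) (≤-trans (*-monoʳ-≤ ρ z′≤1) (≤-trans (≤-reflexive (*-identityʳ ρ)) ρ≤g))
  shared j zero .0 z≤1 _ (inj₂ (inj₂ refl)) rewrite *-zeroʳ ρ = z≤n
  shared j (suc zero) .0 z≤1 _ (inj₂ (inj₂ refl)) rewrite *-zeroʳ ρ | *-identityʳ ρ | +-comm j₀ 1 =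
    *-monoˡ-≤ (δ j (suc j₀)) ρ≤g
  shared j (suc (suc _)) .0 (s≤s ()) _ (inj₂ (inj₂ refl))

  room : ∀ t j → ∑ k (δ j) + (π t * δ j j₀ + π (t + (p ∸ 1)) * δ j (suc j₀)) ≤ B t j
  room t j rewrite π-earlier t = +-monoʳ-≤ (∑ k (δ j))
    (shared j (z t) (z (suc t)) (ζ≤1 n m _) (ζ≤1 n m _) (sparse′ sparse))
    where
    sparse′ : ρ ≡ 0 ⊎ 3 ≤ m → ρ ≡ 0 ⊎ (z t ≡ 0 ⊎ z (suc t) ≡ 0)
    sparse′ (inj₁ ρ≡0) = inj₁ ρ≡0
    sparse′ (inj₂ 3≤m) = inj₂ (ζ-sparse n m t 3≤m)

  ∑-ζδ : ∀ c a → a < n → ∑ p (λ t → z t * δ ((t + c) % n) a) ≡ 1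
  ∑-ζδ c a a<n = trans (∑-ζ n m c (λ j → δ j a) 2≤m) (∑δ≡1 a<n)

  j₀<n : j₀ < n
  j₀<n = <-trans (n<1+n j₀) j₀+1<n

  -- Each class is at age `j₀` at one marked time and at age `j₀ + 1` at one marked time: it cedes
  -- one chunk and takes one extra. Adding 1 on both sides avoids subtraction.
  ∑chunk : ∀ c → ∑ p (λ t → δ ((t + c) % n) (j₀ + z t)) ≡ m
  ∑chunk c = +-cancelʳ-≡ 1 _ _ (begin
    ∑ p (λ t → δ (j t) (j₀ + z t)) + 1
      ≡⟨ cong (∑ p (λ t → δ (j t) (j₀ + z t)) +_) (∑-ζδ c j₀ j₀<n) ⟨
    ∑ p (λ t → δ (j t) (j₀ + z t)) + ∑ p (λ t → z t * δ (j t) j₀)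
      ≡⟨ ∑-+ p _ _ ⟨
    ∑ p (λ t → δ (j t) (j₀ + z t) + z t * δ (j t) j₀)
      ≡⟨ ∑-cong p (λ t → exchange (j t) (z t) (ζ≤1 n m _)) ⟩
    ∑ p (λ t → δ (j t) j₀ + z t * δ (j t) (suc j₀))
      ≡⟨ ∑-+ p _ _ ⟩
    ∑ p (λ t → δ (j t) j₀) + ∑ p (λ t → z t * δ (j t) (suc j₀))
      ≡⟨ cong₂ _+_ (trans (∑-residues m c (λ j → δ j j₀)) (trans (cong (m *_) (∑δ≡1 j₀<n)) (*-identityʳ m))) (∑-ζδ c (suc j₀) j₀+1<n) ⟩
    m + 1 ∎)
    where
    j : ℕ → ℕ
    j t = (t + c) % n
    exchange : ∀ j z → z ≤ 1 → δ j (j₀ + z) + z * δ j j₀ ≡ δ j j₀ + z * δ j (suc j₀)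
    exchange j zero       _ = cong (λ x → δ j x + 0) (+-identityʳ j₀)
    exchange j (suc zero) _ rewrite +-comm j₀ 1 | +-identityʳ (δ j j₀) | +-identityʳ (δ j (suc j₀)) = +-comm (δ j (suc j₀)) (δ j j₀)
    exchange j (suc (suc _)) (s≤s ())

  ∑B : ∀ c → ∑ p (λ t → B t ((t + c) % n)) ≡ m * r
  ∑B c = begin
    ∑ p (λ t → B t ((t + c) % n))
      ≡⟨ ∑-+ p _ _ ⟩
    ∑ p (λ t → ∑ k (δ ((t + c) % n))) + ∑ p (λ t → g * δ ((t + c) % n) (j₀ + z t))
      ≡⟨ cong₂ _+_ (trans (∑-residues m c (λ j → ∑ k (δ j))) (cong (m *_) (∑δ-≤ k (<⇒≤ k<n))))
                   (trans (∑-* p g _) (cong (g *_) (∑chunk c))) ⟩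
    m * k + g * m
      ≡⟨ cong (m * k +_) (*-comm g m) ⟩
    m * k + m * g
      ≡⟨ *-distribˡ-+ m k g ⟨
    m * (k + g)
      ≡⟨ cong (m *_) r≡k+g ⟨
    m * r ∎

  ∑π : ∀ c → ∑ p (λ t → π t * δ ((t + c) % n) j₀) ≡ ρ
  ∑π c = begin
    ∑ p (λ t → ρ * z (suc t) * δ ((t + c) % n) j₀)
      ≡⟨ ∑-cong p (λ t → trans (*-assoc ρ _ _) (cong (ρ *_) (cong₂ _*_ (cong z (+-comm 1 t)) (later t)))) ⟩
    ∑ p (λ t → ρ * f (t + 1))
      ≡⟨ ∑-* p ρ _ ⟩
    ρ * ∑ p (λ t → f (t + 1))
      ≡⟨ cong (ρ *_) (trans (∑-shift 1 f f-periodic) (∑-ζδ c (suc j₀) j₀+1<n)) ⟩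
    ρ * 1
      ≡⟨ *-identityʳ ρ ⟩
    ρ ∎
    where
    f : ℕ → ℕ
    f t = z t * δ ((t + c) % n) (suc j₀)
    f-periodic : Periodic p f
    f-periodic t = cong₂ (λ x y → x * δ y (suc j₀)) (ζ-periodic n m t)
      (trans (cong (_% n) (m+n+o≡m+o+n t p c)) (%-remove-+ʳ (t + c) (n∣m*n m)))
    -- A class of age `j₀` at `t` has age `j₀ + 1` at `t + 1`; this turns the sum into a shift of
    -- the sum over marked times.
    later : ∀ t → δ ((t + c) % n) j₀ ≡ δ ((t + 1 + c) % n) (suc j₀)
    later t = trans (cong (λ x → δ x j₀) (begin
        (t + c) % n                 ≡⟨ %-remove-+ʳ (t + c) (n∣m*n m) ⟨
        (t + c + p) % n             ≡⟨ cong (λ x → (t + c + x) % n) (suc-pred p) ⟨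
        (t + c + suc (p ∸ 1)) % n   ≡⟨ cong (_% n) (shuffle t c (p ∸ 1)) ⟩
        (t + 1 + c + (p ∸ 1)) % n   ∎))
      (trans (δ-%-∸ (t + 1 + c) (n∣m*n m) (>-nonZero⁻¹ p) (subst (_< n) (+-comm 1 j₀) j₀+1<n))
             (cong (δ ((t + 1 + c) % n)) (+-comm j₀ 1)))
      where
      shuffle : ∀ t c x → t + c + suc x ≡ t + 1 + c + x
      shuffle = solve-∀

-- Number of visits, shapes of partitions and the case distinction

ceiling : ∀ q d → ∃[ m ] ∃[ ρ ] ρ ≤ d × q + ρ ≡ m * suc d
-- `q / suc d` rounded up, with the excess `ρ` caused by the rounding: the number of vertices to be
-- saved per class.
ceiling q d = (q + d) / suc d , d ∸ (q + d) % suc d , m∸n≤m d ((q + d) % suc d) ,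
  +-cancelʳ-≡ ((q + d) % suc d) _ _ (begin
    q + (d ∸ (q + d) % suc d) + (q + d) % suc d   ≡⟨ +-assoc q _ _ ⟩
    q + (d ∸ (q + d) % suc d + (q + d) % suc d)   ≡⟨ cong (q +_) (m∸n+n≡m (≤-pred (m%n<n (q + d) (suc d)))) ⟩
    q + d                                         ≡⟨ m≡m%n+[m/n]*n (q + d) (suc d) ⟩
    (q + d) % suc d + (q + d) / suc d * suc d     ≡⟨ +-comm ((q + d) % suc d) _ ⟩
    (q + d) / suc d * suc d + (q + d) % suc d     ∎)
  where open ≡-Reasoning

all-ones-or-big : ∀ {xs} → All (0 <_) xs → xs ≡ replicate (length xs) 1 ⊎ ∃[ u ] ∃[ ys ] 2 ≤ u × xs ↭ u ∷ ys
all-ones-or-big [] = inj₁ refl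
all-ones-or-big {suc zero ∷ xs} (_ ∷ xs>0) with all-ones-or-big xs>0
... | inj₁ eq = inj₁ (cong (1 ∷_) eq)
... | inj₂ (u , ys , 2≤u , xs↭) = inj₂ (u , 1 ∷ ys , 2≤u , ↭-trans (prep 1 xs↭) (swap 1 u ↭-refl))
all-ones-or-big {suc (suc x) ∷ xs} _ = inj₂ (_ , xs , s≤s (s≤s z≤n) , ↭-refl)

-- Extract a part exceeding 1, if there is one, and look for a second among the rest. Hooks include
-- the partition into ones, with `a = 0`.
hook-or-two-big : ∀ {s xs} → All (0 <_) xs → length xs ≡ suc s →
  (∃[ a ] xs ↭ suc a ∷ replicate s 1) ⊎ (∃[ u ] ∃[ v ] ∃[ ys ] 2 ≤ u × 2 ≤ v × xs ↭ u ∷ v ∷ ys)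
hook-or-two-big xs>0 len with all-ones-or-big xs>0
... | inj₁ eq = inj₁ (0 , ↭-reflexive (trans eq (cong (λ l → replicate l 1) len)))
... | inj₂ (suc u , ys , 2≤u , xs↭) with All-resp-↭ xs↭ xs>0
... | _ ∷ ys>0 with all-ones-or-big ys>0
... | inj₁ eq = inj₁ (u , ↭-trans xs↭ (prep (suc u) (↭-reflexive
        (trans eq (cong (λ l → replicate l 1) (suc-injective (trans (sym (↭-length xs↭)) len)))))))
... | inj₂ (v , zs , 2≤v , ys↭) = inj₂ (suc u , v , zs , 2≤u , 2≤v , ↭-trans xs↭ (prep (suc u) ys↭))

length≤sum : ∀ {xs} → All (0 <_) xs → length xs ≤ sum xs
length≤sum []           = z≤n
length≤sum (x>0 ∷ xs>0) = +-mono-≤ x>0 (length≤sum xs>0)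

sum-ones : ∀ s → sum (replicate s 1) ≡ s
sum-ones zero    = refl
sum-ones (suc s) = cong suc (sum-ones s)

theorem4p3 :
    (n r q k : ℕ) → 1 ≤ r → (σ : Partition r) →
    q ≥ largest σ → n ≥ size σ →
    size σ ≥ 2 → 2 ≤ k → k ≤ size σ →
    q ≥ r * (r ∸ 1) → n ≥ size σ + 1 →
    HasIntersectingHamiltonianCycle (σ-hypergraph n q σ) k
theorem4p3 n r q k 1≤r σ _ s≤n _ 2≤k k≤s q≥ n≥s+1 = build (ceiling q (r ∸ k))
  where
  s : ℕ
  s = size σ
  s≤r : s ≤ r
  s≤r = ≤-trans (length≤sum (positive σ)) (≤-reflexive (sum≡r σ))
  k≤r : k ≤ r
  k≤r = ≤-trans k≤s s≤r
  s<n : s < n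
  s<n = subst (_≤ n) (+-comm s 1) n≥s+1
  k<n : k < n
  k<n = ≤-<-trans k≤s s<n
  instance
    n≢0 : NonZero n
    n≢0 = >-nonZero (≤-<-trans z≤n s<n)

  build : ∃[ m ] ∃[ ρ ] ρ ≤ r ∸ k × q + ρ ≡ m * suc (r ∸ k) → HasIntersectingHamiltonianCycle (σ-hypergraph n q σ) k
  build (m , ρ , ρ≤d , q+ρ≡) = cases
    where
    open ≤-Reasoning
    r≤m : r ≤ m
    r≤m = *-cancelʳ-≤ r m (suc (r ∸ k)) (begin
      -- Since `k ≥ 2`, the factor `suc (r ∸ k)` is at most `r ∸ 1`; it is cancelled at the end.
      r * suc (r ∸ k)   ≤⟨ *-monoʳ-≤ r (≤-trans (s≤s (∸-monoʳ-≤ r 2≤k)) (≤-reflexive (sym (+-∸-assoc 1 (≤-trans 2≤k k≤r))))) ⟩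
      r * (r ∸ 1)       ≤⟨ q≥ ⟩
      q                 ≤⟨ m≤m+n q ρ ⟩
      q + ρ             ≡⟨ q+ρ≡ ⟩
      m * suc (r ∸ k)   ∎)
    2≤m : 2 ≤ m
    2≤m = ≤-trans 2≤k (≤-trans k≤r r≤m)
    instance
      m≢0 : NonZero m
      m≢0 = >-nonZero (≤-trans 1≤r r≤m)
    ρ≤m : ρ ≤ m
    ρ≤m = ≤-trans ρ≤d (≤-trans (m∸n≤m r k) r≤m)
    balance : q + ρ + m * k ≡ m * r + m
    balance = trans (cong (_+ m * k) q+ρ≡) (trans (rearrange m (r ∸ k) k) (cong (λ x → m * x + m) (m∸n+n≡m k≤r)))
      where
      rearrange : ∀ m d k → m * suc d + m * k ≡ m * (d + k) + m
      rearrange = solve-∀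

    -- The anchor occupies the ages below `k`; the saved vertex gets ages `k` and `k + 1`, whose
    -- parts are positive.
    long : 2 + k ≤ s → HasIntersectingHamiltonianCycle (σ-hypergraph n q σ) k
    long 2+k≤s = steady {m = m} {j₀ = k} σ 2≤k k<n (<-trans 2+k≤s s<n) ↭-refl s≤n room ρ≤m balance
      where
      room : ∀ j → ∑ k (δ j) + (δ j k + δ j (suc k)) ≤ nth (parts σ) j
      room j = ≤-trans (≤-reflexive (trans (cong (∑ k (δ j) +_) (cong₂ _+_ (cong (δ j) (sym (+-identityʳ k)))
                 (trans (cong (δ j) (+-comm 1 k)) (sym (+-identityʳ _))))) (sym (∑-++ k 2 (δ j)))))
               (∑δ≤nth j (positive σ) (subst (_≤ s) (+-comm 2 k) 2+k≤s))

    -- With the big parts moved to ages 0 and 1, both have room for the saved vertex besides the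
    -- anchor.
    two-big : ∀ {u v ys} → 2 ≤ u → 2 ≤ v → parts σ ↭ u ∷ v ∷ ys → HasIntersectingHamiltonianCycle (σ-hypergraph n q σ) k
    two-big {u} {v} {ys} 2≤u 2≤v σ↭ = steady {m = m} {j₀ = 0} σ 2≤k k<n (<-trans (≤-trans 2≤k k≤s) s<n)
      (↭-sym σ↭) (≤-trans (≤-reflexive (sym (↭-length σ↭))) s≤n) (room 2≤k (subst (k ≤_) (↭-length σ↭) k≤s) (All-resp-↭ σ↭ (positive σ))) ρ≤m balance
      where
      room : ∀ {k} → 2 ≤ k → k ≤ length (u ∷ v ∷ ys) → All (0 <_) (u ∷ v ∷ ys) → ∀ j → ∑ k (δ j) + (δ j 0 + δ j 1) ≤ nth (u ∷ v ∷ ys) j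
      room (s≤s (s≤s {n = k} _)) _ _ 0 rewrite ∑-0 k = 2≤u
      room (s≤s (s≤s {n = k} _)) _ _ 1 rewrite ∑-0 k = 2≤v
      room (s≤s (s≤s {n = k} _)) (s≤s (s≤s k≤l)) (_ ∷ _ ∷ ys>0) (suc (suc j)) = ≤-trans (≤-reflexive (+-identityʳ _)) (∑δ≤nth j ys>0 k≤l)

    hook : ∀ {j₀ g} → suc j₀ < n → r ≡ k + g →
      (∀ i → i ≤ 1 → positives (applyUpTo (λ j → ∑ k (δ j) + g * δ j (j₀ + i)) n) ↭ parts σ) →
      HasIntersectingHamiltonianCycle (σ-hypergraph n q σ) k
    hook {j₀} {g} j₀+1<n r≡k+g profile = travelling {m = m} σ 2≤k k<n j₀+1<n r≡k+g ρ≤g 2≤m (sparse ρ ρ≤g) profile balance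
      where
      ρ≤g : ρ ≤ g
      ρ≤g = ≤-trans ρ≤d (≤-reflexive (trans (cong (_∸ k) r≡k+g) (m+n∸m≡n k g)))
      -- If a vertex has to be saved, then `g ≥ 1`, and `m ≥ r = k + g ≥ 3`.
      sparse : ∀ ρ → ρ ≤ g → ρ ≡ 0 ⊎ 3 ≤ m
      sparse zero    _ = inj₁ refl
      sparse (suc _) ρ≤g = inj₂ (≤-trans (+-mono-≤ 2≤k (≤-trans (s≤s z≤n) ρ≤g)) (≤-trans (≤-reflexive (sym r≡k+g)) r≤m))

    sum-hook : ∀ {a l} → parts σ ↭ suc a ∷ replicate l 1 → r ≡ suc (a + l)
    sum-hook {a} {l} σ↭ = trans (sym (sum≡r σ)) (trans (sum-↭ σ↭) (cong (suc a +_) (sum-ones l)))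

    equal : s ≡ k → HasIntersectingHamiltonianCycle (σ-hypergraph n q σ) k
    equal s≡k with hook-or-two-big (positive σ) (trans s≡k (sym (suc-pred k {{>-nonZero (≤-trans (n≤1+n 1) 2≤k)}})))
    ... | inj₂ (_ , _ , _ , 2≤u , 2≤v , σ↭) = two-big 2≤u 2≤v σ↭
    -- Ages 0 and 1 are both below `k`, so in either place the chunk of `a` vertices joins the
    -- anchor in the part `suc a`.
    ... | inj₁ (a , σ↭) = hook {0} {a} (<-trans 2≤k k<n) r≡ (profile 2≤k σ↭)
      where
      r≡ : r ≡ k + a
      r≡ = trans (sum-hook σ↭) (trans (cong suc (+-comm a _)) (cong (_+ a) (suc-pred k {{>-nonZero (≤-trans (n≤1+n 1) 2≤k)}})))
      profile : 2 ≤ k → parts σ ↭ suc a ∷ replicate (k ∸ 1) 1 → ∀ i → i ≤ 1 → positives (applyUpTo (λ j → ∑ k (δ j) + a * δ j i) n) ↭ parts σ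
      profile (s≤s 1≤k) σ↭ i i≤1 = ↭-trans (profile-inner a (≤-trans i≤1 1≤k) (<⇒≤ k<n)) (↭-sym σ↭)

    oneMore : s ≡ suc k → HasIntersectingHamiltonianCycle (σ-hypergraph n q σ) k
    oneMore s≡1+k with hook-or-two-big (positive σ) s≡1+k
    ... | inj₂ (_ , _ , _ , 2≤u , 2≤v , σ↭) = two-big 2≤u 2≤v σ↭
    -- The chunk is the whole part `suc a`, at age `k` or `k + 1`, just after the anchor; age
    -- `k + 1 = s` exists because `s < n`.
    ... | inj₁ (a , σ↭) = hook {k} {suc a} 1+k<n (trans (sum-hook σ↭) (trans (cong suc (+-comm a k)) (sym (+-suc k a))))
          (λ i i≤1 → ↭-trans (profile-outer a (m≤m+n k i) (≤-<-trans (+-monoʳ-≤ k i≤1) (subst (_< n) (+-comm 1 k) 1+k<n))) (↭-sym σ↭))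
      where
      1+k<n : suc k < n
      1+k<n = subst (_< n) s≡1+k s<n

    cases : HasIntersectingHamiltonianCycle (σ-hypergraph n q σ) k
    cases with m≤n⇒m<n∨m≡n k≤s
    ... | inj₂ k≡s = equal (sym k≡s)
    ... | inj₁ k<s with m≤n⇒m<n∨m≡n k<s
    ...   | inj₁ 2+k≤s = long 2+k≤s
    ...   | inj₂ 1+k≡s = oneMore (sym 1+k≡s)
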